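{- Let $\ell$ be a positive integer. If $\ell \in \{1, 2, 4, 5\}$, then there exists no cubic $\ell$-circulant nut graph. If $\ell \in \{3, 6, 7\}$ or $\ell \ge 9$, then there exist infinitely many (pairwise non-isomorphic) cubic $\ell$-circulant nut graphs.
   Context: A nut graph is a simple graph with at least two vertices whose adjacency matrix has a one-dimensional null space spanned by a vector with no zero entries. For a positive integer $\ell$, an $\ell$-circulant graph is a graph that admits a cyclic group of automorphisms having exactly $\ell$ vertex orbits, all of equal size. A cubic graph is a $3$-regular graph. -}

module Defs where

open import Data.Nat using (ℕ; zero; suc; _≤_; _<_; _*_)
open import Data.Fin using (Fin; zero; suc)
open import Data.Bool using (Bool; true; false; if_then_else_)
open import Data.Rational using (ℚ; 0ℚ; 1ℚ) renaming (_+_ to _+ℚ_; _*_ to _*ℚ_)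
open import Data.Product using (Σ; _×_; ∃; ∃-syntax)
open import Data.Empty using (⊥)
open import Relation.Nullary using (¬_)
open import Relation.Binary.PropositionalEquality using (_≡_; _≢_)
open import Function.Bundles using (_↔_; Inverse)

sumℕ : (n : ℕ) → (Fin n → ℕ) → ℕ
sumℕ zero    f = 0
sumℕ (suc n) f = f zero Data.Nat.+ sumℕ n (λ i → f (suc i))

sumℚ : (n : ℕ) → (Fin n → ℚ) → ℚ
sumℚ zero    f = 0ℚ
sumℚ (suc n) f = f zero +ℚ sumℚ n (λ i → f (suc i))

record Graph (n : ℕ) : Set where
  field
    adj    : Fin n → Fin n → Bool
    sym    : ∀ i j → adj i j ≡ adj j i
    irrefl : ∀ i → adj i i ≡ false
open Graph public

A[_] : ∀ {n} → Graph n → Fin n → Fin n → ℚ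
A[ G ] i j = if adj G i j then 1ℚ else 0ℚ

A·_ : ∀ {n} → Graph n → (Fin n → ℚ) → Fin n → ℚ
(A· G) x i = sumℚ _ (λ j → A[ G ] i j *ℚ x j)

degree : ∀ {n} → Graph n → Fin n → ℕ
degree {n} G i = sumℕ n (λ j → if adj G i j then 1 else 0)

Cubic : ∀ {n} → Graph n → Set
Cubic G = ∀ i → degree G i ≡ 3

InKernel : ∀ {n} → Graph n → (Fin n → ℚ) → Set
InKernel G x = ∀ i → (A· G) x i ≡ 0ℚ

Nut : ∀ {n} → Graph n → Set
Nut {n} G = (2 ≤ n) ×
  (∃[ x ] ((∀ i → x i ≢ 0ℚ) × InKernel G x ×
           (∀ y → InKernel G y → ∃[ c ] (∀ i → y i ≡ c *ℚ x i))))

IsAutomorphism : ∀ {n} → Graph n → (Fin n ↔ Fin n) → Set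
IsAutomorphism G σ = ∀ i j → adj G (Inverse.to σ i) (Inverse.to σ j) ≡ adj G i j

iter : ∀ {A : Set} → ℕ → (A → A) → A → A
iter zero    f a = a
iter (suc k) f a = f (iter k f a)

OrbitSize : ∀ {n} → (Fin n ↔ Fin n) → Fin n → ℕ → Set
OrbitSize σ v m = (iter m (Inverse.to σ) v ≡ v) ×
  (∀ k → 0 < k → k < m → iter k (Inverse.to σ) v ≢ v)

-- ℓ-circulant: some cyclic group of automorphisms ⟨σ⟩ has exactly ℓ vertex
-- orbits, all of equal size m (so n = ℓ · m).
Circulant : ∀ {n} → ℕ → Graph n → Set
Circulant {n} ℓ G = Σ (Fin n ↔ Fin n) (λ σ → IsAutomorphism G σ ×
  ∃[ m ] ((1 ≤ m) × (n ≡ ℓ * m) × (∀ v → OrbitSize σ v m)))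

Isomorphic : ∀ {n m} → Graph n → Graph m → Set
Isomorphic {n} {m} G H = Σ (Fin n ↔ Fin m) (λ φ → ∀ i j →
  adj H (Inverse.to φ i) (Inverse.to φ j) ≡ adj G i j)

AnyGraph : Set
AnyGraph = Σ ℕ Graph

CubicCirculantNut : ℕ → AnyGraph → Set
CubicCirculantNut ℓ (n Data.Product., G) = Cubic G × Circulant ℓ G × Nut G

IsoAny : AnyGraph → AnyGraph → Set
IsoAny (n Data.Product., G) (m Data.Product., H) = Isomorphic G H

{-# OPTIONS --safe #-}

-- Nonexistence. Let x span the kernel and let σ generate the cyclic group. Since x ∘ σ lies in the
-- kernel, x ∘ σ = ±x, so |x| is constant on orbits, with values y_1, ..., y_ℓ > 0. Attaching to each
-- edge uv the sign of x(u)x(v) and counting edges between orbits yields a symmetric integer ℓ × ℓ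
-- matrix B with By = 0, each row of which is a sum of three vectors ±e_j. After sorting y, a small
-- exhaustive search shows that no such pair (B, y) exists for ℓ = 1, 2, 4, 5.
--
-- Existence. Over the cyclic group of order m = 2N, N = 6k + 5, with generator T, take voltage graphs
-- with voltages 1, S = T^N and U^±1 = T^±2, and put P = U + U⁻¹. On 3 orbits the kernel equations
-- reduce to P = 2S, on 7 and on 11 orbits to 2P² + 3SP - 2 = (2P - S)(P + 2S) = 0. The factor 2P - S
-- is injective by 2-adic descent, and P = ±2S forces T = ±1, since (SU)^m = 1 makes a solution of
-- the corresponding second order recurrence constant up to sign. Finally an edge may be replaced by a
-- gadget adding three orbits without changing the kernel, which covers 3, 6, 7 and all ℓ ≥ 9.

module Submission where

open import Defs renaming (sym to adj-sym)
open import Algebra.Bundles using (CommutativeMonoid)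
import Algebra.Properties.CommutativeMonoid.Sum as Sum
open import Data.Bool using (Bool; true; false; _∧_; _∨_; not; T; if_then_else_)
open import Data.Bool.ListAction using (all; any)
open import Data.Bool.Properties using (T-∧; T-∨)
open import Data.Fin as Fin using (Fin; zero; suc; toℕ; combine; remQuot; _↑ˡ_; _↑ʳ_)
open import Data.Fin.Patterns using (0F; 1F; 2F; 3F; 4F; 5F; 6F; 7F; 8F; 9F)
open import Data.Fin.Permutation using (↔⇒≡)
import Data.Fin.Properties as Fin
open import Data.Integer as ℤ using (ℤ; +_; -[1+_]; ∣_∣)
import Data.Integer.Properties as ℤ
import Data.Integer.Solver as ℤSolver
open import Data.List as List using (List; []; _∷_; length; concatMap; allFin)
import Data.List.Membership.DecPropositional as DecMembership
open import Data.List.Membership.Propositional using (_∈_)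
import Data.List.Properties as List
open import Data.List.Relation.Unary.All as All using (All; []; _∷_)
import Data.List.Relation.Unary.All.Properties as All
open import Data.List.Relation.Unary.Any as Any using (Any)
import Data.List.Relation.Unary.Any.Properties as Any
open import Data.Nat as ℕ using (ℕ; zero; suc; _≤_; NonZero)
import Data.Nat.Divisibility as ℕ
import Data.Nat.DivMod as ℕ
import Data.Nat.Properties as ℕ
import Data.Nat.Solver as ℕSolver
open import Data.Product using (Σ; ∃; _×_; _,_; proj₁; proj₂; uncurry)
open import Data.Product.Properties using (≡-dec)
open import Data.Rational as ℚ using (ℚ; mkℚ; 0ℚ; 1ℚ; ↥_; ↧_; _/_; toℚᵘ)
import Data.Rational.Properties as ℚ
import Data.Rational.Solver as ℚSolver
import Data.Rational.Unnormalised as ℚᵘ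
import Data.Rational.Unnormalised.Properties as ℚᵘ
open import Data.Sign as Sign using (Sign)
import Data.Sign.Properties as Sign
open import Data.Sum using (_⊎_; inj₁; inj₂; [_,_]′)
open import Data.Vec as Vec using (Vec; []; _∷_; lookup; tabulate; zipWith)
import Data.Vec.Properties as Vec
open import Function.Base using (_∘_)
open import Function.Bundles using (_↔_; mk↔ₛ′; mk⇔; Inverse; Equivalence)
open import Function.Definitions using (Injective)
open import Level using (0ℓ)
open import Relation.Binary using (DecidableEquality)
open import Relation.Binary.Definitions using (tri<; tri≈; tri>)
open import Relation.Binary.PropositionalEquality
open import Relation.Nullary using (¬_; contradiction; Dec; yes; no; does)
open import Relation.Nullary.Decidable using (dec-false; does-⇔; from-yes; ¬?; _→-dec_; toWitness; fromWitness; ⌊_⌋)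
open import Relation.Unary using (Decidable)

-- Clearing denominators

-- The kernel is computed without roots of unity: a vector is one rational function on the cyclic
-- group per orbit, and the equations are relations between the commuting operators `S` and `U`.
-- Since `T` acts on a rational line, a one-dimensional kernel must have `T = e` with `e = 1` or
-- `e = -1`. The order is chosen accordingly: `N` is prime to 6. Because `N` is odd, `T = e` gives
-- `S = e` and `U = 1`, and `P` is injective; because 3 does not divide `N`, `P - S` is injective
-- too, which the graph on 11 orbits requires. The bases 3, 7 and 11 represent all residues modulo
-- 3, so that adding three orbits at a time reaches every number from 9 on. In the nonexistence
-- part, single rows that vanish on `y` exist as soon as there are two orbits. The obstruction is
-- that `B` is symmetric, which rests on equal orbit sizes: signed edges between two orbits are
-- counted from both ends and the common size cancels. Sorting `y` lets Abel summation refute a row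
-- for all admissible `y` at once, so the search never has to know `y`.

fromℤ : ℤ → ℚ
fromℤ z = z / 1

private
  toℚᵘ-fromℤ : ∀ z → toℚᵘ (fromℤ z) ℚᵘ.≃ ℚᵘ.mkℚᵘ z 0
  toℚᵘ-fromℤ z = ℚ.toℚᵘ-fromℚᵘ (ℚᵘ.mkℚᵘ z 0)

fromℤ-+ : ∀ a b → fromℤ (a ℤ.+ b) ≡ fromℤ a ℚ.+ fromℤ b
fromℤ-+ a b = ℚ.toℚᵘ-injective (ℚᵘ.≃-trans (toℚᵘ-fromℤ (a ℤ.+ b)) (ℚᵘ.≃-sym
  (ℚᵘ.≃-trans (ℚ.toℚᵘ-homo-+ (fromℤ a) (fromℤ b))
  (ℚᵘ.≃-trans (ℚᵘ.+-cong (toℚᵘ-fromℤ a) (toℚᵘ-fromℤ b))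
  (ℚᵘ.*≡* (solve 2 (λ x y → (x :* con (+ 1) :+ y :* con (+ 1)) :* con (+ 1) := (x :+ y) :* con (+ 1)) refl a b))))))
  where open ℤSolver.+-*-Solver

fromℤ-* : ∀ a b → fromℤ (a ℤ.* b) ≡ fromℤ a ℚ.* fromℤ b
fromℤ-* a b = ℚ.toℚᵘ-injective (ℚᵘ.≃-trans (toℚᵘ-fromℤ (a ℤ.* b)) (ℚᵘ.≃-sym
  (ℚᵘ.≃-trans (ℚ.toℚᵘ-homo-* (fromℤ a) (fromℤ b))
  (ℚᵘ.≃-trans (ℚᵘ.*-cong (toℚᵘ-fromℤ a) (toℚᵘ-fromℤ b))
  (ℚᵘ.*≡* refl)))))

fromℤ-injective : ∀ {a b} → fromℤ a ≡ fromℤ b → a ≡ b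
fromℤ-injective {a} {b} eq
  with ℚᵘ.*≡* p ← ℚᵘ.≃-trans (ℚᵘ.≃-sym (toℚᵘ-fromℤ a)) (ℚᵘ.≃-trans (ℚᵘ.≃-reflexive (cong toℚᵘ eq)) (toℚᵘ-fromℤ b))
  = trans (sym (ℤ.*-identityʳ a)) (trans p (ℤ.*-identityʳ b))

fromℤ-↧ : ∀ p → fromℤ (↧ p) ℚ.* p ≡ fromℤ (↥ p)
fromℤ-↧ p@(mkℚ a d _) = ℚ.toℚᵘ-injective
  (ℚᵘ.≃-trans (ℚ.toℚᵘ-homo-* (fromℤ (↧ p)) p)
  (ℚᵘ.≃-trans (ℚᵘ.*-congʳ {toℚᵘ p} (toℚᵘ-fromℤ (↧ p)))
  (ℚᵘ.≃-trans {j = ℚᵘ.mkℚᵘ a 0}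
    (ℚᵘ.*≡* (trans (solve 2 (λ q y → (q :* y) :* con (+ 1) := y :* q) refl (↧ p) a)
                   (cong (λ t → a ℤ.* (+ suc t)) (sym (ℕ.+-identityʳ d)))))
    (ℚᵘ.≃-sym (toℚᵘ-fromℤ (↥ p))))))
  where open ℤSolver.+-*-Solver

-- The denominator is `suc d`, hence nonzero by construction. Integrality serves both the descent
-- below and the nonexistence part, where absolute values are compared as natural numbers.
common-denominator : ∀ n (x : Fin n → ℚ) →
  Σ ℕ λ d → Σ (Fin n → ℤ) λ z → ∀ i → fromℤ (z i) ≡ fromℤ (+ suc d) ℚ.* x i
common-denominator zero    x = 0 , (λ ()) , λ ()
common-denominator (suc n) x = e , z , eq
  where
  rec = common-denominator n (λ i → x (suc i))
  d   = + suc (proj₁ rec)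
  q   = ↧ (x zero)
  e   = ℕ.pred (∣ q ∣ ℕ.* suc (proj₁ rec))
  e≡  : + suc e ≡ q ℤ.* d
  e≡  = ℤ.pos-* (ℚ.↧ₙ (x zero)) (suc (proj₁ rec))
  z : Fin (suc n) → ℤ
  z zero    = ↥ (x zero) ℤ.* d
  z (suc i) = q ℤ.* proj₁ (proj₂ rec) i
  eq : ∀ i → fromℤ (z i) ≡ fromℤ (+ suc e) ℚ.* x i
  eq zero = begin
    fromℤ (↥ (x zero) ℤ.* d)                 ≡⟨ fromℤ-* (↥ (x zero)) d ⟩
    fromℤ (↥ (x zero)) ℚ.* fromℤ d           ≡⟨ cong (ℚ._* fromℤ d) (fromℤ-↧ (x zero)) ⟨
    fromℤ q ℚ.* x zero ℚ.* fromℤ d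
      ≡⟨ solve 3 (λ a b c → a :* b :* c := a :* c :* b) refl (fromℤ q) (x zero) (fromℤ d) ⟩
    fromℤ q ℚ.* fromℤ d ℚ.* x zero           ≡⟨ cong (ℚ._* x zero) (fromℤ-* q d) ⟨
    fromℤ (q ℤ.* d) ℚ.* x zero               ≡⟨ cong (λ t → fromℤ t ℚ.* x zero) e≡ ⟨
    fromℤ (+ suc e) ℚ.* x zero               ∎
    where
    open ≡-Reasoning
    open ℚSolver.+-*-Solver
  eq (suc i) = begin
    fromℤ (q ℤ.* proj₁ (proj₂ rec) i)        ≡⟨ fromℤ-* q (proj₁ (proj₂ rec) i) ⟩
    fromℤ q ℚ.* fromℤ (proj₁ (proj₂ rec) i)  ≡⟨ cong (fromℤ q ℚ.*_) (proj₂ (proj₂ rec) i) ⟩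
    fromℤ q ℚ.* (fromℤ d ℚ.* x (suc i))      ≡⟨ ℚ.*-assoc (fromℤ q) (fromℤ d) (x (suc i)) ⟨
    fromℤ q ℚ.* fromℤ d ℚ.* x (suc i)        ≡⟨ cong (ℚ._* x (suc i)) (fromℤ-* q d) ⟨
    fromℤ (q ℤ.* d) ℚ.* x (suc i)            ≡⟨ cong (λ t → fromℤ t ℚ.* x (suc i)) e≡ ⟨
    fromℤ (+ suc e) ℚ.* x (suc i)            ∎
    where open ≡-Reasoning

*-cancelˡ-0 : ∀ {p q} → p ≢ 0ℚ → p ℚ.* q ≡ 0ℚ → q ≡ 0ℚ
*-cancelˡ-0 {p} {q} p≢0 eq = begin
  q                           ≡⟨ ℚ.*-identityˡ q ⟨
  1ℚ ℚ.* q                    ≡⟨ cong (ℚ._* q) (ℚ.*-inverseˡ p) ⟨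
  (ℚ.1/ p) ℚ.* p ℚ.* q        ≡⟨ ℚ.*-assoc (ℚ.1/ p) p q ⟩
  (ℚ.1/ p) ℚ.* (p ℚ.* q)      ≡⟨ cong ((ℚ.1/ p) ℚ.*_) eq ⟩
  (ℚ.1/ p) ℚ.* 0ℚ             ≡⟨ ℚ.*-zeroʳ (ℚ.1/ p) ⟩
  0ℚ                          ∎
  where
  open ≡-Reasoning
  instance _ = ℚ.≢-nonZero p≢0

fromℤ-suc≢0 : ∀ d → fromℤ (+ suc d) ≢ 0ℚ
fromℤ-suc≢0 d eq with () ← fromℤ-injective {+ suc d} {+ 0} eq

2ℚ : ℚ
2ℚ = 1ℚ ℚ.+ 1ℚ

private
  n<2^n : ∀ n → n ℕ.< 2 ℕ.^ n
  n<2^n zero    = ℕ.s≤s ℕ.z≤n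
  n<2^n (suc n) = ℕ.≤-trans (ℕ.+-mono-≤ (ℕ.m^n>0 2 n) (n<2^n n))
    (ℕ.≤-reflexive (cong (2 ℕ.^ n ℕ.+_) (sym (ℕ.+-identityʳ _))))

-- 2-adic descent: an integer solution is divisible by every power of 2.
halving⇒0ℤ : ∀ {A : Set} (α β : A → A) (z : A → ℤ) →
  (∀ a → z a ≡ + 2 ℤ.* (z (α a) ℤ.+ z (β a))) → ∀ a → z a ≡ + 0
halving⇒0ℤ {A} α β z eq a = ℤ.∣i∣≡0⇒i≡0 (small (2^∣ ∣ z a ∣ z eq a))
  where
  2^∣ : ∀ k (z : A → ℤ) → (∀ a → z a ≡ + 2 ℤ.* (z (α a) ℤ.+ z (β a))) → ∀ a → 2 ℕ.^ k ℕ.∣ ∣ z a ∣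
  2^∣ zero    z eq a = ℕ.1∣ ∣ z a ∣
  2^∣ (suc k) z eq a = subst (2 ℕ.* 2 ℕ.^ k ℕ.∣_)
    (trans (sym (ℤ.abs-* (+ 2) (z′ a))) (cong ∣_∣ (sym (eq a))))
    (ℕ.*-monoʳ-∣ 2 (2^∣ k z′ eq′ a))
    where
    -- The halved solution satisfies the same equation, so the induction runs over all solutions at
    -- once.
    z′ : A → ℤ
    z′ a = z (α a) ℤ.+ z (β a)
    eq′ : ∀ a → z′ a ≡ + 2 ℤ.* (z′ (α a) ℤ.+ z′ (β a))
    eq′ a = trans (cong₂ ℤ._+_ (eq (α a)) (eq (β a))) (sym (ℤ.*-distribˡ-+ (+ 2) (z′ (α a)) (z′ (β a))))
  -- The exponent is the number itself, which lies below that power of 2.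
  small : ∀ {n} → 2 ℕ.^ n ℕ.∣ n → n ≡ 0
  small {zero}  _ = refl
  small {suc n} d = contradiction (ℕ.∣⇒≤ d) (ℕ.<⇒≱ (n<2^n (suc n)))

halving⇒0 : ∀ {n} (α β : Fin n → Fin n) (x : Fin n → ℚ) →
  (∀ i → x i ≡ 2ℚ ℚ.* (x (α i) ℚ.+ x (β i))) → ∀ i → x i ≡ 0ℚ
halving⇒0 {n} α β x eq i with common-denominator n x
... | d , z , zx = *-cancelˡ-0 (fromℤ-suc≢0 d) (trans (sym (zx i)) (cong fromℤ (halving⇒0ℤ α β z eqz i)))
  where
  eqz : ∀ j → z j ≡ + 2 ℤ.* (z (α j) ℤ.+ z (β j))
  eqz j = fromℤ-injective (begin
    fromℤ (z j)                                                  ≡⟨ zx j ⟩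
    D ℚ.* x j                                                    ≡⟨ cong (D ℚ.*_) (eq j) ⟩
    D ℚ.* (2ℚ ℚ.* (x (α j) ℚ.+ x (β j)))
      ≡⟨ solve 4 (λ D t a b → D :* (t :* (a :+ b)) := t :* (D :* a :+ D :* b)) refl D 2ℚ (x (α j)) (x (β j)) ⟩
    2ℚ ℚ.* (D ℚ.* x (α j) ℚ.+ D ℚ.* x (β j))
      ≡⟨ cong (2ℚ ℚ.*_) (cong₂ ℚ._+_ (zx (α j)) (zx (β j))) ⟨
    2ℚ ℚ.* (fromℤ (z (α j)) ℚ.+ fromℤ (z (β j)))                 ≡⟨ cong (2ℚ ℚ.*_) (fromℤ-+ (z (α j)) (z (β j))) ⟨
    fromℤ (+ 2) ℚ.* fromℤ (z (α j) ℤ.+ z (β j))                  ≡⟨ fromℤ-* (+ 2) (z (α j) ℤ.+ z (β j)) ⟨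
    fromℤ (+ 2 ℤ.* (z (α j) ℤ.+ z (β j)))                        ∎)
    where
    open ≡-Reasoning
    open ℚSolver.+-*-Solver
    D = fromℤ (+ suc d)

-- Finite sums

↔-injective : ∀ {A B : Set} (π : A ↔ B) → Injective _≡_ _≡_ (Inverse.to π)
↔-injective π {a} {b} eq = trans (sym (Inverse.strictlyInverseʳ π a))
  (trans (cong (Inverse.from π) eq) (Inverse.strictlyInverseʳ π b))

module ImageSum (M : CommutativeMonoid 0ℓ 0ℓ) where
  open CommutativeMonoid M renaming (refl to ≈-refl; sym to ≈-sym; trans to ≈-trans)
  open Sum M

  sum-0 : ∀ {n} (f : Fin n → Carrier) → (∀ i → f i ≈ ε) → sum f ≈ ε
  sum-0 {n} f eq = ≈-trans (sum-cong-≋ eq) (sum-replicate-zero n)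

  δ-sum : ∀ {n} (a : Fin n) (f : Fin n → Carrier) → sum (λ j → if does (a Fin.≟ j) then f j else ε) ≈ f a
  δ-sum {suc n} zero f = ≈-trans (∙-congˡ (sum-0 {n} (λ _ → ε) (λ _ → ≈-refl))) (identityʳ (f zero))
  δ-sum (suc a) f = ≈-trans (identityˡ _) (δ-sum a (f ∘ suc))

  -- Injectivity turns the indicator of the image of `g` into a sum of point indicators; then the
  -- two sums are exchanged. With `r = 3` this evaluates sums over the neighbours of a vertex.
  image-sum : ∀ {n r} (g : Fin r → Fin n) → Injective _≡_ _≡_ g → (f : Fin n → Carrier) →
    sum (λ j → if does (Fin.any? (λ k → g k Fin.≟ j)) then f j else ε) ≈ sum (f ∘ g)
  image-sum {n} {r} g inj f = ≈-trans (sum-cong-≋ split)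
    (≈-trans (∑-comm (λ j k → if does (g k Fin.≟ j) then f j else ε)) (sum-cong-≋ λ k → δ-sum (g k) f))
    where
    split : ∀ j → (if does (Fin.any? (λ k → g k Fin.≟ j)) then f j else ε) ≈
                  sum (λ k → if does (g k Fin.≟ j) then f j else ε)
    split j with Fin.any? (λ k → g k Fin.≟ j)
    ... | yes (k , refl) = ≈-sym (≈-trans
      (reflexive (sum-cong-≗ λ k′ → cong (if_then f j else ε)
        (does-⇔ (mk⇔ (λ eq → sym (inj eq)) (λ eq → cong g (sym eq))) (g k′ Fin.≟ j) (k Fin.≟ k′))))
      (δ-sum k (λ _ → f j)))
    ... | no ¬∃ = ≈-sym (sum-0 (λ k → if does (g k Fin.≟ j) then f j else ε) λ k → reflexive
      (cong (if_then f j else ε) (dec-false (g k Fin.≟ j) (λ eq → ¬∃ (k , eq)))))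

module SumℕM = Sum ℕ.+-0-commutativeMonoid
module SumℚM = Sum ℚ.+-0-commutativeMonoid

sumℕ≡sum : ∀ n f → sumℕ n f ≡ SumℕM.sum f
sumℕ≡sum zero    f = refl
sumℕ≡sum (suc n) f = cong (f zero ℕ.+_) (sumℕ≡sum n (f ∘ suc))

sumℚ≡sum : ∀ n f → sumℚ n f ≡ SumℚM.sum f
sumℚ≡sum zero    f = refl
sumℚ≡sum (suc n) f = cong (f zero ℚ.+_) (sumℚ≡sum n (f ∘ suc))


-- Existence: nut graphs from voltage graphs over a cyclic group.

module Existence where

  open import Data.Rational using (_+_; _*_; -_)

  module _ where
    open ℕSolver.+-*-Solver

    half+half : ∀ k → (5 ℕ.+ k ℕ.* 6) ℕ.+ (5 ℕ.+ k ℕ.* 6) ≡ 10 ℕ.+ k ℕ.* 12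
    half+half = solve 1 (λ k → (con 5 :+ k :* con 6) :+ (con 5 :+ k :* con 6) := con 10 :+ k :* con 12) refl

    double-order : ∀ k → 2 ℕ.* (10 ℕ.+ k ℕ.* 12) ≡ 20 ℕ.+ k ℕ.* 24
    double-order = solve 1 (λ k → con 2 :* (con 10 :+ k :* con 12) := con 20 :+ k :* con 24) refl

    sextuple-shift : ∀ n → (2 ℕ.+ n ℕ.+ 4) ℕ.+ (2 ℕ.+ n ℕ.+ 4) ≡ 12 ℕ.+ (n ℕ.+ n)
    sextuple-shift = solve 1 (λ n → (con 2 :+ n :+ con 4) :+ (con 2 :+ n :+ con 4) := con 12 :+ (n :+ n)) refl

    half-odd : ∀ k → 1 ℕ.+ (3 ℕ.* k ℕ.* 2 ℕ.+ 4) ≡ 5 ℕ.+ k ℕ.* 6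
    half-odd = solve 1 (λ k → con 1 :+ (con 3 :* k :* con 2 :+ con 4) := con 5 :+ k :* con 6) refl

    half-odd′ : ∀ k → 5 ℕ.+ k ℕ.* 6 ≡ suc ((2 ℕ.+ k ℕ.* 3) ℕ.+ (2 ℕ.+ k ℕ.* 3))
    half-odd′ = solve 1 (λ k → con 5 :+ k :* con 6 := con 1 :+ ((con 2 :+ k :* con 3) :+ (con 2 :+ k :* con 3))) refl

  open ℚSolver.+-*-Solver using (solve; con; _:=_; _:+_; _:*_; :-_)

  pow : ℚ → ℕ → ℚ
  pow e zero    = 1ℚ
  pow e (suc n) = e * pow e n

  pow-+ : ∀ e a b → pow e (a ℕ.+ b) ≡ pow e a * pow e b
  pow-+ e zero    b = sym (ℚ.*-identityˡ (pow e b))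
  pow-+ e (suc a) b = trans (cong (e *_) (pow-+ e a b)) (sym (ℚ.*-assoc e (pow e a) (pow e b)))

  pow-even : ∀ e → e * e ≡ 1ℚ → ∀ n → pow e (n ℕ.+ n) ≡ 1ℚ
  pow-even e ee zero    = refl
  pow-even e ee (suc n) = begin
    e * pow e (n ℕ.+ suc n)    ≡⟨ cong (λ t → e * pow e t) (ℕ.+-suc n n) ⟩
    e * (e * pow e (n ℕ.+ n))  ≡⟨ ℚ.*-assoc e e (pow e (n ℕ.+ n)) ⟨
    e * e * pow e (n ℕ.+ n)    ≡⟨ cong₂ _*_ ee (pow-even e ee n) ⟩
    1ℚ                         ∎
    where open ≡-Reasoning

  -- The cyclic group of order 10 + 12k

  module Cyclic (k : ℕ) where

    N m : ℕ
    N = 5 ℕ.+ k ℕ.* 6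
    m = 10 ℕ.+ k ℕ.* 12

    N+N≡m : N ℕ.+ N ≡ m
    N+N≡m = half+half k

    H : Set
    H = Fin m

    act : ℕ → H → H
    act a h = (toℕ h ℕ.+ a) ℕ.mod m

    toℕ-act : ∀ a h → toℕ (act a h) ≡ (toℕ h ℕ.+ a) ℕ.% m
    toℕ-act a h = Fin.toℕ-fromℕ< (ℕ.m%n<n (toℕ h ℕ.+ a) m)

    %-+ : ∀ a b → (a ℕ.% m ℕ.+ b) ℕ.% m ≡ (a ℕ.+ b) ℕ.% m
    %-+ a b = trans (ℕ.%-distribˡ-+ (a ℕ.% m) b m) (trans
      (cong (λ t → (t ℕ.+ b ℕ.% m) ℕ.% m) (ℕ.m%n%n≡m%n a m)) (sym (ℕ.%-distribˡ-+ a b m)))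

    act-act : ∀ a b h → act a (act b h) ≡ act (b ℕ.+ a) h
    act-act a b h = Fin.toℕ-injective (begin
      toℕ (act a (act b h))                  ≡⟨ toℕ-act a (act b h) ⟩
      (toℕ (act b h) ℕ.+ a) ℕ.% m            ≡⟨ cong (λ t → (t ℕ.+ a) ℕ.% m) (toℕ-act b h) ⟩
      ((toℕ h ℕ.+ b) ℕ.% m ℕ.+ a) ℕ.% m      ≡⟨ %-+ (toℕ h ℕ.+ b) a ⟩
      (toℕ h ℕ.+ b ℕ.+ a) ℕ.% m              ≡⟨ cong (ℕ._% m) (ℕ.+-assoc (toℕ h) b a) ⟩
      (toℕ h ℕ.+ (b ℕ.+ a)) ℕ.% m            ≡⟨ toℕ-act (b ℕ.+ a) h ⟨
      toℕ (act (b ℕ.+ a) h)                  ∎)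
      where open ≡-Reasoning

    act-comm : ∀ a b h → act a (act b h) ≡ act b (act a h)
    act-comm a b h = trans (act-act a b h) (trans (cong (λ t → act t h) (ℕ.+-comm b a)) (sym (act-act b a h)))

    act-0 : ∀ h → act 0 h ≡ h
    act-0 h = Fin.toℕ-injective (trans (toℕ-act 0 h) (trans
      (cong (ℕ._% m) (ℕ.+-identityʳ (toℕ h))) (ℕ.m<n⇒m%n≡m (Fin.toℕ<n h))))

    act-m : ∀ h → act m h ≡ h
    act-m h = Fin.toℕ-injective (trans (toℕ-act m h) (trans
      (ℕ.[m+n]%n≡m%n (toℕ h) m) (ℕ.m<n⇒m%n≡m (Fin.toℕ<n h))))

    S U U⁻ : H → H
    S  = act N
    U  = act 2
    -- The amount is `m - 2`.
    U⁻ = act (8 ℕ.+ k ℕ.* 12)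

    SS : ∀ h → S (S h) ≡ h
    SS h = trans (act-act N N h) (trans (cong (λ t → act t h) N+N≡m) (act-m h))

    U⁻U : ∀ h → U⁻ (U h) ≡ h
    U⁻U h = trans (act-act (8 ℕ.+ k ℕ.* 12) 2 h) (act-m h)

    UU⁻ : ∀ h → U (U⁻ h) ≡ h
    UU⁻ h = trans (act-comm 2 (8 ℕ.+ k ℕ.* 12) h) (U⁻U h)

    US : ∀ h → U (S h) ≡ S (U h)
    US = act-comm 2 N

    U⁻S : ∀ h → U⁻ (S h) ≡ S (U⁻ h)
    U⁻S = act-comm (8 ℕ.+ k ℕ.* 12) N

    Invariant : ℕ → (H → ℚ) → Set
    Invariant a x = ∀ h → x (act a h) ≡ x h

    module _ {x : H → ℚ} where

      inv-+ : ∀ {a b} → Invariant a x → Invariant b x → Invariant (a ℕ.+ b) x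
      inv-+ {a} {b} p q h = trans (cong x (sym (act-act b a h))) (trans (q (act a h)) (p h))

      inv-* : ∀ q {a} → Invariant a x → Invariant (q ℕ.* a) x
      inv-* zero    p h = cong x (act-0 h)
      inv-* (suc q) {a} p = inv-+ {a} {q ℕ.* a} p (inv-* q p)

      -- One step of the Euclidean algorithm on periods; chains of such steps replace a gcd
      -- computation.
      inv-cancel : ∀ b {a} → Invariant a x → Invariant (b ℕ.+ a) x → Invariant b x
      inv-cancel b {a} p q h = trans (sym (p (act b h))) (trans (cong x (act-act a b h)) (q h))

      inv-m : Invariant m x
      inv-m h = cong x (act-m h)

      -- The gcd of 12 and `m` is 2: removing `k` copies of 12 from `m = 10 + 12k` leaves 10, and
      -- `12 - 10 = 2`. That `N` is prime to 6 enters here.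
      inv12⇒inv2 : Invariant 12 x → Invariant 2 x
      inv12⇒inv2 p = inv-cancel 2 (inv-cancel 10 (inv-* k p) inv-m) p

      antiperiodic⇒inv : ∀ a → (∀ h → x (act a h) ≡ - x h) → Invariant (a ℕ.+ a) x
      antiperiodic⇒inv a p h = trans (cong x (sym (act-act a a h)))
        (trans (p (act a h)) (trans (cong -_ (p h)) (solve 1 (λ t → :- (:- t) := t) refl (x h))))

    x≡-x⇒x≡0 : ∀ {x} → x ≡ - x → x ≡ 0ℚ
    x≡-x⇒x≡0 {x} eq = *-cancelˡ-0 {2ℚ} (λ ()) (begin
      2ℚ * x    ≡⟨ solve 1 (λ t → con 2ℚ :* t := t :+ t) refl x ⟩
      x + x     ≡⟨ cong (_+ x) eq ⟩
      - x + x   ≡⟨ ℚ.+-inverseˡ x ⟩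
      0ℚ        ∎)
      where open ≡-Reasoning

    -- In the comments, P denotes the operator U + U⁻.

    -- P is injective since the square of U has odd order.
    P-injective : ∀ (x : H → ℚ) → (∀ h → x (U h) + x (U⁻ h) ≡ 0ℚ) → ∀ h → x h ≡ 0ℚ
    P-injective x eq h = x≡-x⇒x≡0 (trans (sym (inv4 h)) (anti h))
      where
      -- `Px = 0` means `U² = -1` on `x`, hence periods 8 and 24. With `2m = 20 + 24k` the periods
      -- 20 and `4 = 24 - 20` follow, so `U²` is also the identity on `x`.
      anti : ∀ h → x (act 4 h) ≡ - x h
      anti h = begin
        x (act 4 h)                       ≡⟨ cong x (act-act 2 2 h) ⟨
        x (U (U h))                       ≡⟨ solve 2 (λ a b → a := (a :+ b) :+ :- b) refl (x (U (U h))) (x (U⁻ (U h))) ⟩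
        x (U (U h)) + x (U⁻ (U h)) + - x (U⁻ (U h)) ≡⟨ cong₂ (λ a b → a + - x b) (eq (U h)) (U⁻U h) ⟩
        0ℚ + - x h                        ≡⟨ ℚ.+-identityˡ (- x h) ⟩
        - x h                             ∎
        where open ≡-Reasoning
      inv8 : Invariant 8 x
      inv8 = antiperiodic⇒inv {x} 4 anti
      inv24 : Invariant 24 x
      inv24 = inv-* {x} 3 inv8
      2m≡ : 2 ℕ.* m ≡ 20 ℕ.+ k ℕ.* 24
      2m≡ = double-order k
      inv20 : Invariant 20 x
      inv20 = inv-cancel {x} 20 (inv-* {x} k inv24) (subst (λ t → Invariant t x) 2m≡ (inv-* {x} 2 inv-m))
      inv4 : Invariant 4 x
      inv4 = inv-cancel {x} 4 inv20 inv24

    -- If P = S then (SU)³ = -1, hence U⁶ = 1 and, by coprimality, U = 1.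
    P-S-injective : ∀ (x : H → ℚ) → (∀ h → x (U h) + x (U⁻ h) ≡ x (S h)) → ∀ h → x h ≡ 0ℚ
    -- Once `U = 1`, the hypothesis becomes `2x = Sx`, and applying it twice gives `4x = x`.
    P-S-injective x eq h = *-cancelˡ-0 {2ℚ + 1ℚ} (λ ()) (begin
      (2ℚ + 1ℚ) * x h  ≡⟨ solve 1 (λ a → con (2ℚ + 1ℚ) :* a := con 2ℚ :* (con 2ℚ :* a) :+ :- a) refl (x h) ⟩
      2ℚ * (2ℚ * x h) + - x h   ≡⟨ cong (λ t → 2ℚ * t + - x h) (2x≡Sx h) ⟩
      2ℚ * x (S h) + - x h      ≡⟨ cong (_+ - x h) (2x≡Sx (S h)) ⟩
      x (S (S h)) + - x h       ≡⟨ cong (λ t → x t + - x h) (SS h) ⟩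
      x h + - x h               ≡⟨ ℚ.+-inverseʳ (x h) ⟩
      0ℚ                        ∎)
      where
      open ≡-Reasoning
      V : H → H
      V h = S (U h)
      VV : ∀ h → V (V h) ≡ U (U h)
      VV h = trans (cong S (US (U h))) (SS (U (U h)))
      step : ∀ h → x (V (V h)) ≡ x (V h) + - x h
      step h = begin
        x (V (V h))                                    ≡⟨ cong x (VV h) ⟩
        x (U (U h))                                    ≡⟨ solve 2 (λ a b → a := (a :+ b) :+ :- b) refl (x (U (U h))) (x (U⁻ (U h))) ⟩
        x (U (U h)) + x (U⁻ (U h)) + - x (U⁻ (U h))    ≡⟨ cong₂ (λ a b → a + - x b) (eq (U h)) (U⁻U h) ⟩
        x (V h) + - x h                                ∎
      V³ : ∀ h → x (V (V (V h))) ≡ - x h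
      V³ h = trans (step (V h)) (trans (cong (_+ - x (V h)) (step h))
        (solve 2 (λ a b → (a :+ :- b) :+ :- a := :- b) refl (x (V h)) (x h)))
      -- `V³ = SU · U²` is the shift by `2 + N + 4`. Doubled, this is `12 + m`, so 12 is a period.
      anti : ∀ h → x (act (2 ℕ.+ N ℕ.+ 4) h) ≡ - x h
      anti h = trans (cong x (begin
        act (2 ℕ.+ N ℕ.+ 4) h           ≡⟨ act-act 4 (2 ℕ.+ N) h ⟨
        act 4 (act (2 ℕ.+ N) h)         ≡⟨ cong (act 4) (act-act N 2 h) ⟨
        act 4 (V h)                     ≡⟨ act-act 2 2 (V h) ⟨
        U (U (V h))                     ≡⟨ VV (V h) ⟨
        V (V (V h))                     ∎)) (V³ h)
      inv12 : Invariant 12 x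
      inv12 = inv-cancel {x} 12 inv-m (subst (λ t → Invariant t x) eqn (antiperiodic⇒inv {x} (2 ℕ.+ N ℕ.+ 4) anti))
        where
        eqn : (2 ℕ.+ N ℕ.+ 4) ℕ.+ (2 ℕ.+ N ℕ.+ 4) ≡ 12 ℕ.+ m
        eqn = trans (sextuple-shift N) (cong (12 ℕ.+_) N+N≡m)
      inv2 : Invariant 2 x
      inv2 = inv12⇒inv2 {x} inv12
      2x≡Sx : ∀ h → 2ℚ * x h ≡ x (S h)
      2x≡Sx h = begin
        2ℚ * x h            ≡⟨ solve 1 (λ a → con 2ℚ :* a := a :+ a) refl (x h) ⟩
        x h + x h           ≡⟨ cong₂ _+_ (inv2 h) (trans (sym (inv2 (U⁻ h))) (cong x (UU⁻ h))) ⟨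
        x (U h) + x (U⁻ h)  ≡⟨ eq h ⟩
        x (S h)             ∎

    -- The image of `n` in `ℚ`, in the recursive form in which the progression `arith` produces it.
    nth : ℕ → ℚ
    nth zero    = 0ℚ
    nth (suc n) = 1ℚ + nth n

    -- If P = 2eS with e = ±1, then eSU - 1 squares to 0; as SU has finite order, eSU = 1.
    P-2eS-kernel : ∀ e → e * e ≡ 1ℚ → ∀ (x : H → ℚ) →
      (∀ h → x (U h) + x (U⁻ h) ≡ 2ℚ * (e * x (S h))) → ∀ h → x (act 1 h) ≡ e * x h
    P-2eS-kernel e ee x eq h = begin
      x (act 1 h)              ≡⟨ ℚ.*-identityˡ (x (act 1 h)) ⟨
      1ℚ * x (act 1 h)         ≡⟨ cong₂ _*_ ee (inv2′ (act 1 h)) ⟨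
      e * e * x (act (3 ℕ.* k ℕ.* 2 ℕ.+ 4) (act 1 h)) ≡⟨ cong (λ t → e * e * x t) (trans (act-act (3 ℕ.* k ℕ.* 2 ℕ.+ 4) 1 h) (cong (λ t → act t h) eqn)) ⟩
      e * e * x (S h)          ≡⟨ ℚ.*-assoc e e (x (S h)) ⟩
      e * (e * x (S h))        ≡⟨ cong (e *_) (x∘U h) ⟨
      e * x (U h)              ≡⟨ cong (e *_) (inv2 h) ⟩
      e * x h                  ∎
      where
      open ≡-Reasoning
      V : H → H
      V = act (2 ℕ.+ N)
      V≡ : ∀ h → V h ≡ S (U h)
      V≡ h = sym (act-act N 2 h)
      -- `d = (eV - 1)x` is fixed by `eV`, so `e^q x(V^q h)` is an arithmetic progression in `q`
      -- with difference `d h`. After `m` steps, `m` being even, it is back at `x h`; hence `m`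
      -- times `d h` vanishes.
      d : H → ℚ
      d h = e * x (V h) + - x h
      d-step : ∀ h → e * d (V h) ≡ d h
      d-step h = begin
        e * (e * x (V (V h)) + - x (V h))
          ≡⟨ solve 3 (λ e a b → e :* (e :* a :+ :- b) := (e :* e) :* a :+ :- (e :* b)) refl e (x (V (V h))) (x (V h)) ⟩
        e * e * x (V (V h)) + - (e * x (V h))
          ≡⟨ cong₂ (λ a b → a * b + - (e * x (V h))) ee (trans (cong x VVh) (sym uu)) ⟩
        1ℚ * (2ℚ * (e * x (V h)) + - x h) + - (e * x (V h))
          ≡⟨ solve 2 (λ a b → con 1ℚ :* (con 2ℚ :* a :+ :- b) :+ :- a := a :+ :- b) refl (e * x (V h)) (x h) ⟩
        e * x (V h) + - x h ∎
        where
        VVh : V (V h) ≡ U (U h)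
        VVh = trans (V≡ (V h)) (trans (cong (λ t → S (U t)) (V≡ h)) (trans (cong S (US (U h))) (SS (U (U h)))))
        uu : 2ℚ * (e * x (V h)) + - x h ≡ x (U (U h))
        uu = begin
          2ℚ * (e * x (V h)) + - x h              ≡⟨ cong (λ t → 2ℚ * (e * x t) + - x h) (V≡ h) ⟩
          2ℚ * (e * x (S (U h))) + - x h          ≡⟨ cong₂ (λ a b → a + - x b) (eq (U h)) (U⁻U h) ⟨
          x (U (U h)) + x (U⁻ (U h)) + - x (U⁻ (U h)) ≡⟨ solve 2 (λ a b → (a :+ b) :+ :- b := a) refl (x (U (U h))) (x (U⁻ (U h))) ⟩
          x (U (U h))                             ∎
      V^ : ℕ → H → H
      V^ zero    h = h
      V^ (suc q) h = V (V^ q h)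
      V^-act : ∀ q h → V^ q h ≡ act (q ℕ.* (2 ℕ.+ N)) h
      V^-act zero    h = sym (act-0 h)
      V^-act (suc q) h = trans (cong V (V^-act q h)) (trans (act-act (2 ℕ.+ N) (q ℕ.* (2 ℕ.+ N)) h)
        (cong (λ t → act t h) (ℕ.+-comm (q ℕ.* (2 ℕ.+ N)) (2 ℕ.+ N))))
      pow-d : ∀ q h → pow e q * d (V^ q h) ≡ d h
      pow-d zero    h = ℚ.*-identityˡ (d h)
      pow-d (suc q) h = trans
        (solve 3 (λ e f a → (e :* f) :* a := f :* (e :* a)) refl e (pow e q) (d (V (V^ q h))))
        (trans (cong (pow e q *_) (d-step (V^ q h))) (pow-d q h))
      arith : ∀ q h → pow e q * x (V^ q h) ≡ x h + nth q * d h
      arith zero    h = solve 2 (λ a b → con 1ℚ :* a := a :+ con 0ℚ :* b) refl (x h) (d h)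
      arith (suc q) h = begin
        e * pow e q * x (V (V^ q h))
          ≡⟨ solve 4 (λ e f a b → e :* f :* a := f :* (e :* a :+ :- b) :+ f :* b) refl e (pow e q) (x (V (V^ q h))) (x (V^ q h)) ⟩
        pow e q * d (V^ q h) + pow e q * x (V^ q h)  ≡⟨ cong₂ _+_ (pow-d q h) (arith q h) ⟩
        d h + (x h + nth q * d h)
          ≡⟨ solve 3 (λ a b c → a :+ (b :+ c :* a) := b :+ (con 1ℚ :+ c) :* a) refl (d h) (x h) (nth q) ⟩
        x h + (1ℚ + nth q) * d h             ∎
      nth-m≢0 : nth m ≢ 0ℚ
      nth-m≢0 eq0 = fromℤ-suc≢0 (9 ℕ.+ k ℕ.* 12) (trans (nth≡ m) eq0)
        where
        nth≡ : ∀ n → fromℤ (+ n) ≡ nth n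
        nth≡ zero    = refl
        nth≡ (suc n) = trans (fromℤ-+ (+ 1) (+ n)) (cong (λ t → 1ℚ + t) (nth≡ n))
      V^m : ∀ h → V^ m h ≡ h
      V^m h = trans (V^-act m h) (Fin.toℕ-injective (trans (toℕ-act (m ℕ.* (2 ℕ.+ N)) h) (trans
        (cong (λ t → (toℕ h ℕ.+ t) ℕ.% m) (ℕ.*-comm m (2 ℕ.+ N)))
        (trans (ℕ.[m+kn]%n≡m%n (toℕ h) (2 ℕ.+ N) m) (ℕ.m<n⇒m%n≡m (Fin.toℕ<n h))))))
      d≡0 : ∀ h → d h ≡ 0ℚ
      d≡0 h = *-cancelˡ-0 nth-m≢0 (begin
        nth m * d h                       ≡⟨ solve 2 (λ a b → b := (a :+ b) :+ :- a) refl (x h) (nth m * d h) ⟩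
        x h + nth m * d h + - x h         ≡⟨ cong (_+ - x h) (arith m h) ⟨
        pow e m * x (V^ m h) + - x h          ≡⟨ cong₂ (λ a b → a * x b + - x h) (trans (cong (pow e) (sym N+N≡m)) (pow-even e ee N)) (V^m h) ⟩
        1ℚ * x h + - x h                  ≡⟨ solve 1 (λ a → con 1ℚ :* a :+ :- a := con 0ℚ) refl (x h) ⟩
        0ℚ                                ∎)
      x∘V : ∀ h → e * x (V h) ≡ x h
      x∘V h = begin
        e * x (V h)     ≡⟨ solve 2 (λ a b → a := (a :+ :- b) :+ b) refl (e * x (V h)) (x h) ⟩
        d h + x h       ≡⟨ cong (_+ x h) (d≡0 h) ⟩
        0ℚ + x h        ≡⟨ ℚ.+-identityˡ (x h) ⟩
        x h             ∎
      x∘U : ∀ h → x (U h) ≡ e * x (S h)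
      x∘U h = sym (begin
        e * x (S h)          ≡⟨ cong (e *_) (x∘V (S h)) ⟨
        e * (e * x (V (S h))) ≡⟨ ℚ.*-assoc e e (x (V (S h))) ⟨
        e * e * x (V (S h))  ≡⟨ cong₂ (λ a b → a * x b) ee (trans (V≡ (S h)) (trans (cong S (US h)) (SS (U h)))) ⟩
        1ℚ * x (U h)         ≡⟨ ℚ.*-identityˡ (x (U h)) ⟩
        x (U h)              ∎)
      -- `eSU = 1` squares to `U² = 1`.
      inv4 : Invariant 4 x
      inv4 h = begin
        x (act 4 h)          ≡⟨ cong x (act-act 2 2 h) ⟨
        x (U (U h))          ≡⟨ x∘U (U h) ⟩
        e * x (S (U h))      ≡⟨ cong (λ t → e * x t) (V≡ h) ⟨
        e * x (V h)          ≡⟨ x∘V h ⟩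
        x h                  ∎
      inv2 : Invariant 2 x
      inv2 = inv12⇒inv2 {x} (inv-* {x} 3 inv4)
      inv2′ : Invariant (3 ℕ.* k ℕ.* 2 ℕ.+ 4) x
      inv2′ = inv-+ {x} (inv-* {x} (3 ℕ.* k) inv2) inv4
      -- `N - 1 = 6k + 4` is even, so under period 2 the shift `S = T^N` acts as `T`.
      eqn : 1 ℕ.+ (3 ℕ.* k ℕ.* 2 ℕ.+ 4) ≡ N
      eqn = half-odd k

    Eigen : ℚ → (H → ℚ) → Set
    Eigen e f = ∀ h → f (act 1 h) ≡ e * f h

    eigen-act : ∀ e f → Eigen e f → ∀ a h → f (act a h) ≡ pow e a * f h
    eigen-act e f p zero    h = trans (cong f (act-0 h)) (sym (ℚ.*-identityˡ (f h)))
    eigen-act e f p (suc a) h = begin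
      f (act (suc a) h)        ≡⟨ cong f (act-act a 1 h) ⟨
      f (act a (act 1 h))      ≡⟨ eigen-act e f p a (act 1 h) ⟩
      pow e a * f (act 1 h)    ≡⟨ cong (pow e a *_) (p h) ⟩
      pow e a * (e * f h)      ≡⟨ solve 3 (λ a e x → a :* (e :* x) := (e :* a) :* x) refl (pow e a) e (f h) ⟩
      e * pow e a * f h        ∎
      where open ≡-Reasoning

    module _ (e : ℚ) (ee : e * e ≡ 1ℚ) where

      pow-N : pow e N ≡ e
      pow-N = begin
        pow e N                              ≡⟨ cong (pow e) (half-odd′ k) ⟩
        e * pow e (half ℕ.+ half)            ≡⟨ cong (e *_) (pow-even e ee half) ⟩
        e * 1ℚ                               ≡⟨ ℚ.*-identityʳ e ⟩
        e                                    ∎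
        where
        open ≡-Reasoning
        half = 2 ℕ.+ k ℕ.* 3

      pow-% : ∀ a → pow e (a ℕ.% m) ≡ pow e a
      pow-% a = sym (begin
        pow e a                                       ≡⟨ cong (pow e) (ℕ.m≡m%n+[m/n]*n a m) ⟩
        pow e (a ℕ.% m ℕ.+ q ℕ.* m)                   ≡⟨ pow-+ e (a ℕ.% m) (q ℕ.* m) ⟩
        pow e (a ℕ.% m) * pow e (q ℕ.* m)             ≡⟨ cong (λ t → pow e (a ℕ.% m) * pow e t) q*m ⟩
        pow e (a ℕ.% m) * pow e (q ℕ.* N ℕ.+ q ℕ.* N) ≡⟨ cong (pow e (a ℕ.% m) *_) (pow-even e ee (q ℕ.* N)) ⟩
        pow e (a ℕ.% m) * 1ℚ                          ≡⟨ ℚ.*-identityʳ (pow e (a ℕ.% m)) ⟩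
        pow e (a ℕ.% m)                               ∎)
        where
        open ≡-Reasoning
        q = a ℕ./ m
        q*m : q ℕ.* m ≡ q ℕ.* N ℕ.+ q ℕ.* N
        q*m = trans (cong (q ℕ.*_) (sym N+N≡m)) (ℕ.*-distribˡ-+ q N N)

      -- The character of the cyclic group that sends `T` to `e`; it is multiplicative across the
      -- wrap-around because `e² = 1` and `m` is even.
      χ : H → ℚ
      χ h = pow e (toℕ h)

      χ-eigen : Eigen e χ
      χ-eigen h = trans (cong (pow e) (toℕ-act 1 h)) (trans (pow-% (toℕ h ℕ.+ 1)) (cong (pow e) (ℕ.+-comm (toℕ h) 1)))

      χ-χ≡1 : ∀ h → χ h * χ h ≡ 1ℚ
      χ-χ≡1 h = trans (sym (pow-+ e (toℕ h) (toℕ h))) (pow-even e ee (toℕ h))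

      eigen⇒χ : ∀ f → Eigen e f → ∀ h → f h ≡ f zero * χ h
      eigen⇒χ f p h = begin
        f h                  ≡⟨ cong f h≡ ⟩
        f (act (toℕ h) zero) ≡⟨ eigen-act e f p (toℕ h) zero ⟩
        χ h * f zero         ≡⟨ ℚ.*-comm (χ h) (f zero) ⟩
        f zero * χ h         ∎
        where
        open ≡-Reasoning
        h≡ : h ≡ act (toℕ h) zero
        h≡ = Fin.toℕ-injective (sym (trans (toℕ-act (toℕ h) zero) (ℕ.m<n⇒m%n≡m (Fin.toℕ<n h))))

      module _ (f : H → ℚ) (p : Eigen e f) where

        eigen-S : ∀ h → f (S h) ≡ e * f h
        eigen-S h = trans (eigen-act e f p N h) (cong (_* f h) pow-N)

        eigen-U : ∀ h → f (U h) ≡ f h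
        eigen-U h = trans (eigen-act e f p 2 h) (trans (cong (_* f h) (pow-even e ee 1)) (ℚ.*-identityˡ (f h)))

        eigen-U⁻ : ∀ h → f (U⁻ h) ≡ f h
        eigen-U⁻ h = trans (sym (eigen-U (U⁻ h))) (cong f (UU⁻ h))

  -- Elimination by means of the ring solver: the solver proves `c = d + (a - b)` as an identity,
  -- and the known equation `a ≡ b` removes the correction. The unknowns of the linear systems below
  -- are eliminated in this way.
  +-cancel-≡ : ∀ {a b c d} → a ≡ b → c ≡ d + (a + - b) → c ≡ d
  +-cancel-≡ {a} {d = d} refl eq = trans eq (trans (cong (λ t → d + t) (ℚ.+-inverseʳ a)) (ℚ.+-identityʳ d))

  3ℚ -1ℚ : ℚ
  3ℚ  = 1ℚ + 2ℚ
  -1ℚ = - 1ℚ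

  -- The quadratic equation shared by the bases on 7 and 11 orbits.

  module Quadratic (k : ℕ) where
    open Cyclic k

    -- 2P² + 3SP - 2 = (2P - S)(P + 2S), and 2P - S is injective by 2-adic descent.
    quadratic-kernel : ∀ (x : H → ℚ) (let Q = λ h → 2ℚ * (x (U h) + x (U⁻ h)) + 3ℚ * x (S h)) →
      (∀ h → 2ℚ * x h ≡ Q (U h) + Q (U⁻ h)) → ∀ h → x (act 1 h) ≡ -1ℚ * x h
    quadratic-kernel x eq = P-2eS-kernel -1ℚ refl x (λ h → begin
      x (U h) + x (U⁻ h)
        ≡⟨ solve 3 (λ a b c → a :+ b := (a :+ b :+ con 2ℚ :* c) :+ con 2ℚ :* (con -1ℚ :* c)) refl (x (U h)) (x (U⁻ h)) (x (S h)) ⟩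
      y h + 2ℚ * (-1ℚ * x (S h))   ≡⟨ cong (_+ 2ℚ * (-1ℚ * x (S h))) (y≡0 h) ⟩
      0ℚ + 2ℚ * (-1ℚ * x (S h))    ≡⟨ ℚ.+-identityˡ _ ⟩
      2ℚ * (-1ℚ * x (S h))         ∎)
      where
      open ≡-Reasoning
      Q : H → ℚ
      Q h = 2ℚ * (x (U h) + x (U⁻ h)) + 3ℚ * x (S h)
      -- `y = (P + 2S)x` is killed by `2P - S`. Multiplied by `S`, this reads `y = 2(SU + SU⁻)y`,
      -- the form that the descent needs.
      y : H → ℚ
      y h = x (U h) + x (U⁻ h) + 2ℚ * x (S h)
      y-SU : ∀ h → y (S (U h)) ≡ x (S (U (U h))) + x (S h) + 2ℚ * x (U h)
      y-SU h = cong₂ _+_ (cong₂ _+_ (cong x (US (U h))) (cong x (trans (U⁻S (U h)) (cong S (U⁻U h)))))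
        (cong (λ t → 2ℚ * x t) (SS (U h)))
      y-SU⁻ : ∀ h → y (S (U⁻ h)) ≡ x (S h) + x (S (U⁻ (U⁻ h))) + 2ℚ * x (U⁻ h)
      y-SU⁻ h = cong₂ _+_ (cong₂ _+_ (cong x (trans (US (U⁻ h)) (cong S (UU⁻ h)))) (cong x (U⁻S (U⁻ h))))
        (cong (λ t → 2ℚ * x t) (SS (U⁻ h)))
      Q-US : ∀ h → Q (U (S h)) ≡ 2ℚ * (x (S (U (U h))) + x (S h)) + 3ℚ * x (U h)
      Q-US h = cong₂ _+_ (cong (2ℚ *_) (cong₂ _+_ (cong x (trans (cong U (US h)) (US (U h)))) (cong x (U⁻U (S h)))))
        (cong (λ t → 3ℚ * x t) (trans (cong S (US h)) (SS (U h))))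
      Q-U⁻S : ∀ h → Q (U⁻ (S h)) ≡ 2ℚ * (x (S h) + x (S (U⁻ (U⁻ h)))) + 3ℚ * x (U⁻ h)
      Q-U⁻S h = cong₂ _+_ (cong (2ℚ *_) (cong₂ _+_ (cong x (UU⁻ (S h))) (cong x (trans (cong U⁻ (U⁻S h)) (U⁻S (U⁻ h))))))
        (cong (λ t → 3ℚ * x t) (trans (cong S (U⁻S h)) (SS (U⁻ h))))
      y-step : ∀ h → y h ≡ 2ℚ * (y (S (U h)) + y (S (U⁻ h)))
      y-step h = +-cancel-≡ (trans (eq (S h)) (cong₂ _+_ (Q-US h) (Q-U⁻S h)))
        (trans
          (solve 5 (λ s u v a b → u :+ v :+ con 2ℚ :* s :=
              con 2ℚ :* ((a :+ s :+ con 2ℚ :* u) :+ (s :+ b :+ con 2ℚ :* v)) :+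
              (con 2ℚ :* s :+ :- ((con 2ℚ :* (a :+ s) :+ con 3ℚ :* u) :+ (con 2ℚ :* (s :+ b) :+ con 3ℚ :* v)))) refl
            (x (S h)) (x (U h)) (x (U⁻ h)) (x (S (U (U h)))) (x (S (U⁻ (U⁻ h)))))
          (cong (λ t → 2ℚ * t + (2ℚ * x (S h) + - ((2ℚ * (x (S (U (U h))) + x (S h)) + 3ℚ * x (U h)) +
              (2ℚ * (x (S h) + x (S (U⁻ (U⁻ h)))) + 3ℚ * x (U⁻ h))))) (sym (cong₂ _+_ (y-SU h) (y-SU⁻ h)))))
      y≡0 : ∀ h → y h ≡ 0ℚ
      y≡0 = halving⇒0 (λ h → S (U h)) (λ h → S (U⁻ h)) y y-step

  -- Voltage graphs

  data Shift : Set where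
    stay flip up down : Shift

  inverse : Shift → Shift
  inverse stay = stay
  inverse flip = flip
  inverse up   = down
  inverse down = up

  -- (j , l , s) is the dart leading to slot l of orbit j with voltage s.
  Dart : ℕ → Set
  Dart ℓ = Fin ℓ × Fin 3 × Shift

  -- A cubic voltage graph given by three darts per orbit. A loop of voltage `flip` is a single
  -- dart, its own mate; a loop of voltage `up` consists of two. `simple` and `loopless` make the
  -- derived graph simple. The last three fields mark an edge of voltage `stay` at slot 2 of orbit
  -- `zero`, the one that the gadget replaces.
  record Voltage (n : ℕ) : Set where
    field
      nb       : Fin (suc n) → Fin 3 → Dart (suc n)
      mate     : ∀ {i k j l s} → nb i k ≡ (j , l , s) → nb j l ≡ (i , k , inverse s)
      simple   : ∀ {i k k′ j l l′ s} → nb i k ≡ (j , l , s) → nb i k′ ≡ (j , l′ , s) → k ≡ k′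
      loopless : ∀ {i k l} → nb i k ≢ (i , l , stay)
      out      : Fin n
      slot     : Fin 3
      top      : nb zero 2F ≡ (suc out , slot , stay)

  -- The edge between u = orbit 0 and v = orbit `suc out` is replaced by a gadget on three new
  -- orbits q, p, r (with indices 0, 1, 2), each joined to itself by an edge of voltage `flip`.
  -- In the kernel it forces p = Sv, q = u and r = -(Su + v), so that u and v see what they saw before.
  module _ {n : ℕ} where

    3+_ : Fin (suc n) → Fin (4 ℕ.+ n)
    3+ i = suc (suc (suc i))

    -- Slot 2 of `zero` is the end at u of the marked edge. A dart ending there is redirected to
    -- slot 2 of q; the others are only renumbered.
    lift : Dart (suc n) → Dart (4 ℕ.+ n)
    lift (zero  , 2F , s) = zero , 2F , s
    lift (zero  , 0F , s) = 3+ zero , 0F , s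
    lift (zero  , 1F , s) = 3+ zero , 1F , s
    lift (suc j , l  , s) = 3+ suc j , l , s

    data NotTop : Fin (suc n) → Fin 3 → Set where
      z0 : NotTop zero 0F
      z1 : NotTop zero 1F
      sj : ∀ {j l} → NotTop (suc j) l

    lift-notTop : ∀ {j l s} → NotTop j l → lift (j , l , s) ≡ (3+ j , l , s)
    lift-notTop z0 = refl
    lift-notTop z1 = refl
    lift-notTop sj = refl

    notTop? : ∀ j l → (j ≡ zero × l ≡ 2F) ⊎ NotTop j l
    notTop? zero    0F = inj₂ z0
    notTop? zero    1F = inj₂ z1
    notTop? zero    2F = inj₁ (refl , refl)
    notTop? (suc j) l  = inj₂ sj

    lift-≡ : ∀ {d d′ j l l′ s} → lift d ≡ (j , l , s) → lift d′ ≡ (j , l′ , s) →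
      proj₁ d ≡ proj₁ d′ × proj₂ (proj₂ d) ≡ proj₂ (proj₂ d′)
    lift-≡ {zero  , 0F , _} {zero  , 0F , _} refl refl = refl , refl
    lift-≡ {zero  , 0F , _} {zero  , 1F , _} refl refl = refl , refl
    lift-≡ {zero  , 0F , _} {zero  , 2F , _} refl ()
    lift-≡ {zero  , 0F , _} {suc _ , _  , _} refl ()
    lift-≡ {zero  , 1F , _} {zero  , 0F , _} refl refl = refl , refl
    lift-≡ {zero  , 1F , _} {zero  , 1F , _} refl refl = refl , refl
    lift-≡ {zero  , 1F , _} {zero  , 2F , _} refl ()
    lift-≡ {zero  , 1F , _} {suc _ , _  , _} refl ()
    lift-≡ {zero  , 2F , _} {zero  , 0F , _} refl ()
    lift-≡ {zero  , 2F , _} {zero  , 1F , _} refl ()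
    lift-≡ {zero  , 2F , _} {zero  , 2F , _} refl refl = refl , refl
    lift-≡ {zero  , 2F , _} {suc _ , _  , _} refl ()
    lift-≡ {suc _ , _  , _} {zero  , 0F , _} refl ()
    lift-≡ {suc _ , _  , _} {zero  , 1F , _} refl ()
    lift-≡ {suc _ , _  , _} {zero  , 2F , _} refl ()
    lift-≡ {suc _ , _  , _} {suc _ , _  , _} refl refl = refl , refl

    -- No lifted dart leads to p, so the new dart from u to p is parallel to no old one.
    lift-≢1 : ∀ {d l s} → lift d ≢ (1F , l , s)
    lift-≢1 {zero  , 0F , _} ()
    lift-≢1 {zero  , 1F , _} ()
    lift-≢1 {zero  , 2F , _} ()
    lift-≢1 {suc _ , _  , _} ()

    lift-3+ : ∀ {d j l s} → lift d ≡ (3+ j , l , s) → d ≡ (j , l , s)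
    lift-3+ {zero  , 0F , _} refl = refl
    lift-3+ {zero  , 1F , _} refl = refl
    lift-3+ {zero  , 2F , _} ()
    lift-3+ {suc _ , _  , _} refl = refl

  module Extension {n : ℕ} (V : Voltage n) where
    open Voltage V

    old : Fin (suc n) → Fin 3 → Dart (4 ℕ.+ n)
    old zero    0F = lift (nb zero 0F)
    old zero    1F = lift (nb zero 1F)
    old zero    2F = 1F , 2F , flip
    old (suc i) k  = lift (nb (suc i) k)

    old-notTop : ∀ {i k} → NotTop i k → old i k ≡ lift (nb i k)
    old-notTop z0 = refl
    old-notTop z1 = refl
    old-notTop sj = refl

    nb⁺ : Fin (4 ℕ.+ n) → Fin 3 → Dart (4 ℕ.+ n)
    nb⁺ 0F 0F = 0F , 0F , flip
    nb⁺ 0F 1F = 2F , 0F , stay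
    -- q takes over the dart from u to v. This is again a marked edge, so the extension can be
    -- iterated.
    nb⁺ 0F 2F = lift (nb zero 2F)
    nb⁺ 1F 0F = 1F , 0F , flip
    nb⁺ 1F 1F = 2F , 1F , stay
    nb⁺ 1F 2F = 3+ zero , 2F , flip
    nb⁺ 2F 0F = 0F , 1F , stay
    nb⁺ 2F 1F = 1F , 1F , stay
    nb⁺ 2F 2F = 2F , 2F , flip
    nb⁺ (suc (suc (suc i))) k = old i k

    lift-top : lift (nb zero 2F) ≡ (3+ suc out , slot , stay)
    lift-top = cong lift top

    mate-old : ∀ {i k} d → NotTop i k → nb i k ≡ d →
      nb⁺ (proj₁ (lift d)) (proj₁ (proj₂ (lift d))) ≡ (3+ i , k , inverse (proj₂ (proj₂ (lift d))))
    mate-old (j , l , s) nt eq with notTop? j l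
    ... | inj₁ (refl , refl) = trans (cong lift (mate eq)) (lift-notTop nt)
    ... | inj₂ nt′ rewrite lift-notTop {s = s} nt′ =
      trans (old-notTop nt′) (trans (cong lift (mate eq)) (lift-notTop nt))

    mate⁺ : ∀ i k {j l s} → nb⁺ i k ≡ (j , l , s) → nb⁺ j l ≡ (i , k , inverse s)
    mate⁺ 0F 0F refl = refl
    mate⁺ 0F 1F refl = refl
    mate⁺ 0F 2F eq with refl ← trans (sym lift-top) eq = cong lift (mate top)
    mate⁺ 1F 0F refl = refl
    mate⁺ 1F 1F refl = refl
    mate⁺ 1F 2F refl = refl
    mate⁺ 2F 0F refl = refl
    mate⁺ 2F 1F refl = refl
    mate⁺ 2F 2F refl = refl
    mate⁺ (suc (suc (suc i))) k eq with notTop? i k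
    mate⁺ (suc (suc (suc i))) k refl | inj₁ (refl , refl) = refl
    mate⁺ (suc (suc (suc i))) k eq   | inj₂ nt with refl ← trans (sym (old-notTop nt)) eq = mate-old (nb i k) nt refl

    simple⁺ : ∀ i k k′ {j l l′ s} → nb⁺ i k ≡ (j , l , s) → nb⁺ i k′ ≡ (j , l′ , s) → k ≡ k′
    simple⁺ 0F 0F 0F _ _ = refl
    simple⁺ 0F 0F 1F refl ()
    simple⁺ 0F 0F 2F refl q with () ← trans (sym lift-top) q
    simple⁺ 0F 1F 0F refl ()
    simple⁺ 0F 1F 1F _ _ = refl
    simple⁺ 0F 1F 2F refl q with () ← trans (sym lift-top) q
    simple⁺ 0F 2F 0F q refl with () ← trans (sym lift-top) q
    simple⁺ 0F 2F 1F q refl with () ← trans (sym lift-top) q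
    simple⁺ 0F 2F 2F _ _ = refl
    simple⁺ 1F 0F 0F _ _ = refl
    simple⁺ 1F 0F 1F refl ()
    simple⁺ 1F 0F 2F refl ()
    simple⁺ 1F 1F 0F refl ()
    simple⁺ 1F 1F 1F _ _ = refl
    simple⁺ 1F 1F 2F refl ()
    simple⁺ 1F 2F 0F refl ()
    simple⁺ 1F 2F 1F refl ()
    simple⁺ 1F 2F 2F _ _ = refl
    simple⁺ 2F 0F 0F _ _ = refl
    simple⁺ 2F 0F 1F refl ()
    simple⁺ 2F 0F 2F refl ()
    simple⁺ 2F 1F 0F refl ()
    simple⁺ 2F 1F 1F _ _ = refl
    simple⁺ 2F 1F 2F refl ()
    simple⁺ 2F 2F 0F refl ()
    simple⁺ 2F 2F 1F refl ()
    simple⁺ 2F 2F 2F _ _ = refl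
    simple⁺ (suc (suc (suc i))) k k′ p q with notTop? i k | notTop? i k′
    ... | inj₁ (refl , refl) | inj₁ (_ , refl) = refl
    ... | inj₁ (refl , refl) | inj₂ nt with refl ← p =
      contradiction (trans (sym (old-notTop nt)) q) (lift-≢1 {d = nb zero k′})
    ... | inj₂ nt | inj₁ (refl , refl) with refl ← q =
      contradiction (trans (sym (old-notTop nt)) p) (lift-≢1 {d = nb zero k})
    ... | inj₂ nt | inj₂ nt′ = simple {i} {k} {k′} refl (cong₂ (λ a b → a , proj₁ (proj₂ (nb i k′)) , b) (sym (proj₁ same)) (sym (proj₂ same)))
      where same = lift-≡ {d = nb i k} {nb i k′} (trans (sym (old-notTop nt)) p) (trans (sym (old-notTop nt′)) q)

    loopless⁺ : ∀ i k {l} → nb⁺ i k ≢ (i , l , stay)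
    loopless⁺ 0F 0F ()
    loopless⁺ 0F 1F ()
    loopless⁺ 0F 2F eq with () ← trans (sym lift-top) eq
    loopless⁺ 1F 0F ()
    loopless⁺ 1F 1F ()
    loopless⁺ 1F 2F ()
    loopless⁺ 2F 0F ()
    loopless⁺ 2F 1F ()
    loopless⁺ 2F 2F ()
    loopless⁺ (suc (suc (suc i))) k eq with notTop? i k
    loopless⁺ (suc (suc (suc i))) k ()  | inj₁ (refl , refl)
    loopless⁺ (suc (suc (suc i))) k eq  | inj₂ nt =
      loopless (lift-3+ {d = nb i k} (trans (sym (old-notTop nt)) eq))

    extend : Voltage (3 ℕ.+ n)
    extend = record
      { nb = nb⁺ ; mate = λ {i} {k} → mate⁺ i k ; simple = λ {i} {k} {k′} → simple⁺ i k k′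
      ; loopless = λ {i} {k} → loopless⁺ i k
      ; out = suc (suc (suc out)) ; slot = slot ; top = lift-top }

  -- Kernel equations of a voltage graph, and their behaviour under extension.

  module Kernel (k : ℕ) where
    open Cyclic k

    move : Shift → H → H
    move stay h = h
    move flip = S
    move up   = U
    move down = U⁻

    value : ∀ {ℓ} → (Fin ℓ → H → ℚ) → Dart ℓ → H → ℚ
    value x (j , _ , s) h = x j (move s h)

    Solution : ∀ {n} → Voltage n → (Fin (suc n) → H → ℚ) → Set
    Solution V x = ∀ i h → value x (nb i 0F) h + value x (nb i 1F) h + value x (nb i 2F) h ≡ 0ℚ
      where open Voltage V

    module Weighted (e : ℚ) where

      -- The values of the character `χ` on the voltages: `S = T^N` with `N` odd goes to `e`, and
      -- `U = T²` goes to 1.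
      sign : Shift → ℚ
      sign stay = 1ℚ
      sign flip = e
      sign up   = 1ℚ
      sign down = 1ℚ

      weight : ∀ {ℓ} → (Fin ℓ → ℚ) → Dart ℓ → ℚ
      weight w (j , _ , s) = sign s * w j

      -- Every kernel vector is `w i * f h` with `f` in the `e`-eigenspace of `T`, which `χ` spans.
      -- `w-top` concerns, up to sign, the weight that the third orbit of a gadget receives. The
      -- extension reproduces it literally, because q has the weight of u and v keeps its own.
      record NutVoltage {n} (V : Voltage n) : Set where
        open Voltage V
        field
          w        : Fin (suc n) → ℚ
          w≢0      : ∀ i → w i ≢ 0ℚ
          w-top    : e * w zero + w (suc out) ≢ 0ℚ
          balanced : ∀ i → weight w (nb i 0F) + weight w (nb i 1F) + weight w (nb i 2F) ≡ 0ℚ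
          unique   : ∀ x → Solution V x → Σ (H → ℚ) λ f → Eigen e f × (∀ i h → x i h ≡ w i * f h)

      module _ (ee : e * e ≡ 1ℚ) where

        -- At `S h` the equation of r involves `q (S h)`, `p (S h)` and `r h`; comparing it with
        -- those of q and p at `h` gives `p-S` and `q-S`. Hence the old orbits solve the old
        -- equations, and `unique` carries over.
        extend-nut : ∀ {n} (V : Voltage n) → NutVoltage V → NutVoltage (Extension.extend V)
        extend-nut {n} V ν = record { w = w⁺ ; w≢0 = w⁺≢0 ; w-top = w-top ; balanced = balanced⁺ ; unique = unique⁺ }
          where
          open Voltage V
          open Extension V
          open NutVoltage ν
          open ≡-Reasoning

          w⁺ : Fin (4 ℕ.+ n) → ℚ
          w⁺ 0F = w zero
          w⁺ 1F = e * w (suc out)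
          w⁺ 2F = - (e * w zero + w (suc out))
          w⁺ (suc (suc (suc i))) = w i

          w⁺≢0 : ∀ i → w⁺ i ≢ 0ℚ
          w⁺≢0 0F eq = w≢0 zero eq
          w⁺≢0 1F eq = w≢0 (suc out) (begin
            w (suc out)            ≡⟨ ℚ.*-identityˡ _ ⟨
            1ℚ * w (suc out)       ≡⟨ cong (_* w (suc out)) ee ⟨
            e * e * w (suc out)    ≡⟨ ℚ.*-assoc e e _ ⟩
            e * (e * w (suc out))  ≡⟨ cong (e *_) eq ⟩
            e * 0ℚ                 ≡⟨ ℚ.*-zeroʳ e ⟩
            0ℚ                     ∎)
          w⁺≢0 2F eq = w-top (trans (solve 1 (λ a → a := :- (:- a)) refl (e * w zero + w (suc out))) (cong -_ eq))
          w⁺≢0 (suc (suc (suc i))) eq = w≢0 i eq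

          weight-lift : ∀ d → weight w⁺ (lift d) ≡ weight w d
          weight-lift (zero  , 0F , s) = refl
          weight-lift (zero  , 1F , s) = refl
          weight-lift (zero  , 2F , s) = refl
          weight-lift (suc _ , _  , s) = refl

          weight-old : ∀ i k → weight w⁺ (old i k) ≡ weight w (nb i k)
          weight-old i k with notTop? i k
          ... | inj₁ (refl , refl) = begin
            e * (e * w (suc out))  ≡⟨ ℚ.*-assoc e e _ ⟨
            e * e * w (suc out)    ≡⟨ cong (_* w (suc out)) ee ⟩
            1ℚ * w (suc out)       ≡⟨ cong (weight w) top ⟨
            weight w (nb zero 2F)  ∎
          ... | inj₂ nt = trans (cong (weight w⁺) (old-notTop nt)) (weight-lift (nb i k))

          balanced⁺ : ∀ i → weight w⁺ (nb⁺ i 0F) + weight w⁺ (nb⁺ i 1F) + weight w⁺ (nb⁺ i 2F) ≡ 0ℚ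
          balanced⁺ 0F = trans
            (cong (λ d → e * w zero + 1ℚ * (- (e * w zero + w (suc out))) + weight w⁺ d) lift-top)
            (solve 3 (λ e a b → e :* a :+ con 1ℚ :* (:- (e :* a :+ b)) :+ con 1ℚ :* b := con 0ℚ) refl e (w zero) (w (suc out)))
          balanced⁺ 1F = +-cancel-≡ (cong (_* w (suc out)) ee)
            (solve 3 (λ e a b → e :* (e :* b) :+ con 1ℚ :* (:- (e :* a :+ b)) :+ e :* a := con 0ℚ :+ (e :* e :* b :+ :- (con 1ℚ :* b))) refl
              e (w zero) (w (suc out)))
          balanced⁺ 2F = +-cancel-≡ (sym (cong (_* w zero) ee))
            (solve 3 (λ e a b → con 1ℚ :* a :+ con 1ℚ :* (e :* b) :+ e :* (:- (e :* a :+ b)) := con 0ℚ :+ (con 1ℚ :* a :+ :- (e :* e :* a))) refl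
              e (w zero) (w (suc out)))
          balanced⁺ (suc (suc (suc i))) = trans
            (cong₂ _+_ (cong₂ _+_ (weight-old i 0F) (weight-old i 1F)) (weight-old i 2F)) (balanced i)

          unique⁺ : ∀ x⁺ → Solution extend x⁺ → Σ (H → ℚ) λ f → Eigen e f × (∀ i h → x⁺ i h ≡ w⁺ i * f h)
          unique⁺ x⁺ sol⁺ = f , f-eigen , x⁺≡
            where
            x : Fin (suc n) → H → ℚ
            x i = x⁺ (3+ i)

            E₀ : ∀ h → x⁺ 0F (S h) + x⁺ 2F h + x (suc out) h ≡ 0ℚ
            E₀ h = trans (cong (λ d → x⁺ 0F (S h) + x⁺ 2F h + value x⁺ d h) (sym lift-top)) (sol⁺ 0F h)

            E₁ : ∀ h → x⁺ 1F (S h) + x⁺ 2F h + x zero (S h) ≡ 0ℚ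
            E₁ = sol⁺ 1F

            E₂ : ∀ h → x⁺ 0F (S h) + x⁺ 1F (S h) + x⁺ 2F h ≡ 0ℚ
            E₂ h = trans (cong (λ t → x⁺ 0F (S h) + x⁺ 1F (S h) + x⁺ 2F t) (sym (SS h))) (sol⁺ 2F (S h))

            p-S : ∀ h → x⁺ 1F (S h) ≡ x (suc out) h
            p-S h = +-cancel-≡ (trans (E₂ h) (sym (E₀ h)))
              (solve 4 (λ p q r v → p := v :+ ((q :+ p :+ r) :+ :- (q :+ r :+ v))) refl
                (x⁺ 1F (S h)) (x⁺ 0F (S h)) (x⁺ 2F h) (x (suc out) h))

            q-S : ∀ h → x⁺ 0F (S h) ≡ x zero (S h)
            q-S h = +-cancel-≡ (trans (E₂ h) (sym (E₁ h)))
              (solve 4 (λ p q r u → q := u :+ ((q :+ p :+ r) :+ :- (p :+ r :+ u))) refl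
                (x⁺ 1F (S h)) (x⁺ 0F (S h)) (x⁺ 2F h) (x zero (S h)))

            q≡ : ∀ h → x⁺ 0F h ≡ x zero h
            q≡ h = trans (cong (x⁺ 0F) (sym (SS h))) (trans (q-S (S h)) (cong (x zero) (SS h)))

            value-lift : ∀ d h → value x⁺ (lift d) h ≡ value x d h
            value-lift (zero  , 0F , s) h = refl
            value-lift (zero  , 1F , s) h = refl
            value-lift (zero  , 2F , s) h = q≡ (move s h)
            value-lift (suc _ , _  , s) h = refl

            value-old : ∀ i k h → value x⁺ (old i k) h ≡ value x (nb i k) h
            value-old i k h with notTop? i k
            ... | inj₁ (refl , refl) = trans (p-S h) (cong (λ d → value x d h) (sym top))
            ... | inj₂ nt = trans (cong (λ d → value x⁺ d h) (old-notTop nt)) (value-lift (nb i k) h)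

            sol : Solution V x
            sol i h = trans
              (sym (cong₂ _+_ (cong₂ _+_ (value-old i 0F h) (value-old i 1F h)) (value-old i 2F h))) (sol⁺ (3+ i) h)

            f       = proj₁ (unique x sol)
            f-eigen = proj₁ (proj₂ (unique x sol))
            x≡      = proj₂ (proj₂ (unique x sol))

            x⁺≡ : ∀ i h → x⁺ i h ≡ w⁺ i * f h
            x⁺≡ 0F h = trans (q≡ h) (x≡ zero h)
            x⁺≡ 1F h = begin
              x⁺ 1F h                   ≡⟨ cong (x⁺ 1F) (SS h) ⟨
              x⁺ 1F (S (S h))           ≡⟨ p-S (S h) ⟩
              x (suc out) (S h)         ≡⟨ x≡ (suc out) (S h) ⟩
              w (suc out) * f (S h)     ≡⟨ cong (w (suc out) *_) (eigen-S e ee f f-eigen h) ⟩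
              w (suc out) * (e * f h)   ≡⟨ solve 3 (λ w e f → w :* (e :* f) := e :* w :* f) refl (w (suc out)) e (f h) ⟩
              e * w (suc out) * f h     ∎
            x⁺≡ 2F h = begin
              x⁺ 2F h                                                    ≡⟨ +-cancel-≡ (E₀ h)
                (solve 3 (λ q r v → r := :- (q :+ v) :+ ((q :+ r :+ v) :+ :- con 0ℚ)) refl (x⁺ 0F (S h)) (x⁺ 2F h) (x (suc out) h)) ⟩
              - (x⁺ 0F (S h) + x (suc out) h)                            ≡⟨ cong₂ (λ a b → - (a + b))
                (trans (q-S h) (trans (x≡ zero (S h)) (cong (w zero *_) (eigen-S e ee f f-eigen h)))) (x≡ (suc out) h) ⟩
              - (w zero * (e * f h) + w (suc out) * f h)
                ≡⟨ solve 4 (λ u v e f → :- (u :* (e :* f) :+ v :* f) := :- (e :* u :+ v) :* f) refl (w zero) (w (suc out)) e (f h) ⟩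
              - (e * w zero + w (suc out)) * f h                         ∎
            x⁺≡ (suc (suc (suc i))) h = x≡ i h

  -- The base voltage graphs on 3, 7 and 11 orbits.

  _≟ˢ_ : DecidableEquality Shift
  stay ≟ˢ stay = yes refl
  stay ≟ˢ flip = no λ ()
  stay ≟ˢ up   = no λ ()
  stay ≟ˢ down = no λ ()
  flip ≟ˢ stay = no λ ()
  flip ≟ˢ flip = yes refl
  flip ≟ˢ up   = no λ ()
  flip ≟ˢ down = no λ ()
  up   ≟ˢ stay = no λ ()
  up   ≟ˢ flip = no λ ()
  up   ≟ˢ up   = yes refl
  up   ≟ˢ down = no λ ()
  down ≟ˢ stay = no λ ()
  down ≟ˢ flip = no λ ()
  down ≟ˢ up   = no λ ()
  down ≟ˢ down = yes refl

  module _ {n : ℕ} (nb : Fin (suc n) → Fin 3 → Dart (suc n)) where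

    end : Fin (suc n) → Fin 3 → Fin (suc n) × Shift
    end i k = proj₁ (nb i k) , proj₂ (proj₂ (nb i k))

    Mated : Set
    Mated = ∀ i k → nb (proj₁ (nb i k)) (proj₁ (proj₂ (nb i k))) ≡ (i , k , inverse (proj₂ (proj₂ (nb i k))))

    Separated : Set
    Separated = ∀ i k k′ → end i k ≡ end i k′ → k ≡ k′

    Loopless : Set
    Loopless = ∀ i k → end i k ≢ (i , stay)

    mated? : Dec Mated
    mated? = Fin.all? λ i → Fin.all? λ k → ≡-dec Fin._≟_ (≡-dec Fin._≟_ _≟ˢ_) _ _

    separated? : Dec Separated
    separated? = Fin.all? λ i → Fin.all? λ k → Fin.all? λ k′ → ≡-dec Fin._≟_ _≟ˢ_ _ _ →-dec k Fin.≟ k′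

    loopless? : Dec Loopless
    loopless? = Fin.all? λ i → Fin.all? λ k → ¬? (≡-dec Fin._≟_ _≟ˢ_ _ _)

    voltage : Mated → Separated → Loopless → ∀ {out slot} → nb zero 2F ≡ (suc out , slot , stay) → Voltage n
    voltage mt sp lp {out} {slot} top = record
      { nb = nb
      ; mate = λ {i} {k} eq → trans (cong (λ (j , l , _) → nb j l) (sym eq)) (trans (mt i k) (cong (λ (_ , _ , s) → i , k , inverse s) eq))
      ; simple = λ {i} {k} {k′} p q → sp i k k′ (trans (cong (λ (j , _ , s) → j , s) p) (sym (cong (λ (j , _ , s) → j , s) q)))
      ; loopless = λ {i} {k} eq → lp i k (cong (λ (j , _ , s) → j , s) eq)
      ; out = out ; slot = slot ; top = top }

  -- Two orbits with a loop `U` hang on one with a loop `S`. Injectivity of `P` gives `x₀ = x₁`,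
  -- then `x₂ = -Px₀`, and the last equation becomes `P = 2S`.
  nb₃ : Fin 3 → Fin 3 → Dart 3
  nb₃ 0F 0F = 0F , 1F , up
  nb₃ 0F 1F = 0F , 0F , down
  nb₃ 0F 2F = 2F , 0F , stay
  nb₃ 1F 0F = 1F , 1F , up
  nb₃ 1F 1F = 1F , 0F , down
  nb₃ 1F 2F = 2F , 1F , stay
  nb₃ 2F 0F = 0F , 2F , stay
  nb₃ 2F 1F = 1F , 2F , stay
  nb₃ 2F 2F = 2F , 2F , flip

  -- Orbits 2 and 3 are both joined to 1 and 4 and have a loop `S`, so they carry the same function
  -- `X`. Then `x₀ = x₅ = -2X`, `x₁ = 2PX`, `x₄ = -(2P + S)X`, `x₆ = (2P + 3S)X`, and the equation
  -- of orbit 6 is `P(2P + 3S)X = 2X`.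
  nb₇ : Fin 7 → Fin 3 → Dart 7
  nb₇ 0F 0F = 0F , 1F , up
  nb₇ 0F 1F = 0F , 0F , down
  nb₇ 0F 2F = 1F , 0F , stay
  nb₇ 1F 0F = 0F , 2F , stay
  nb₇ 1F 1F = 2F , 0F , stay
  nb₇ 1F 2F = 3F , 0F , stay
  nb₇ 2F 0F = 1F , 1F , stay
  nb₇ 2F 1F = 4F , 0F , stay
  nb₇ 2F 2F = 2F , 2F , flip
  nb₇ 3F 0F = 1F , 2F , stay
  nb₇ 3F 1F = 4F , 1F , stay
  nb₇ 3F 2F = 3F , 2F , flip
  nb₇ 4F 0F = 2F , 1F , stay
  nb₇ 4F 1F = 3F , 1F , stay
  nb₇ 4F 2F = 5F , 0F , stay
  nb₇ 5F 0F = 4F , 2F , stay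
  nb₇ 5F 1F = 6F , 2F , stay
  nb₇ 5F 2F = 5F , 2F , flip
  nb₇ 6F 0F = 6F , 1F , up
  nb₇ 6F 1F = 6F , 0F , down
  nb₇ 6F 2F = 5F , 1F , stay

  pattern 10F = suc 9F

  -- A tree with loops: the joined orbits 3 and 7 carry, at 3, two equal tails through 2, 1, 0 and
  -- 6, 5, 4, and at 7 a tail through 8, 9 and the leaf 10. The tails determine `x₇` from `X = x₃`,
  -- and the equation of the leaf becomes the quadratic one.
  nb₁₁ : Fin 11 → Fin 3 → Dart 11
  nb₁₁ 0F 0F = 0F , 1F , up
  nb₁₁ 0F 1F = 0F , 0F , down
  nb₁₁ 0F 2F = 1F , 0F , stay
  nb₁₁ 1F 0F = 0F , 2F , stay
  nb₁₁ 1F 1F = 1F , 1F , flip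
  nb₁₁ 1F 2F = 2F , 0F , stay
  nb₁₁ 2F 0F = 1F , 2F , stay
  nb₁₁ 2F 1F = 2F , 1F , flip
  nb₁₁ 2F 2F = 3F , 0F , stay
  nb₁₁ 3F 0F = 2F , 2F , stay
  nb₁₁ 3F 1F = 6F , 2F , stay
  nb₁₁ 3F 2F = 7F , 0F , stay
  nb₁₁ 4F 0F = 4F , 1F , up
  nb₁₁ 4F 1F = 4F , 0F , down
  nb₁₁ 4F 2F = 5F , 0F , stay
  nb₁₁ 5F 0F = 4F , 2F , stay
  nb₁₁ 5F 1F = 5F , 1F , flip
  nb₁₁ 5F 2F = 6F , 0F , stay
  nb₁₁ 6F 0F = 5F , 2F , stay
  nb₁₁ 6F 1F = 6F , 1F , flip
  nb₁₁ 6F 2F = 3F , 1F , stay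
  nb₁₁ 7F 0F = 3F , 2F , stay
  nb₁₁ 7F 1F = 8F , 2F , stay
  nb₁₁ 7F 2F = 10F , 2F , stay
  nb₁₁ 8F 0F = 9F , 2F , stay
  nb₁₁ 8F 1F = 8F , 1F , flip
  nb₁₁ 8F 2F = 7F , 1F , stay
  nb₁₁ 9F 0F = 9F , 1F , up
  nb₁₁ 9F 1F = 9F , 0F , down
  nb₁₁ 9F 2F = 8F , 0F , stay
  nb₁₁ 10F 0F = 10F , 1F , up
  nb₁₁ 10F 1F = 10F , 0F , down
  nb₁₁ 10F 2F = 7F , 2F , stay

  V₃ : Voltage 2
  V₃ = voltage nb₃ (from-yes (mated? nb₃)) (from-yes (separated? nb₃)) (from-yes (loopless? nb₃)) refl

  V₇ : Voltage 6
  V₇ = voltage nb₇ (from-yes (mated? nb₇)) (from-yes (separated? nb₇)) (from-yes (loopless? nb₇)) refl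

  V₁₁ : Voltage 10
  V₁₁ = voltage nb₁₁ (from-yes (mated? nb₁₁)) (from-yes (separated? nb₁₁)) (from-yes (loopless? nb₁₁)) refl

  -- Solving the kernel equations of the base graphs.

  module Bases (k : ℕ) where
    open Cyclic k
    open Kernel k
    open Quadratic k
    open ≡-Reasoning

    nut₃ : Weighted.NutVoltage 1ℚ V₃
    nut₃ = record
      { w = w ; w≢0 = from-yes (Fin.all? λ i → ¬? (w i ℚ.≟ 0ℚ)) ; w-top = λ ()
      ; balanced = from-yes (Fin.all? λ i → (weight w (nb₃ i 0F) + weight w (nb₃ i 1F) + weight w (nb₃ i 2F)) ℚ.≟ 0ℚ)
      ; unique = λ x sol → x 0F , eig x sol , x≡ x sol }
      where
      open Weighted 1ℚ
      w : Fin 3 → ℚ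
      w 0F = 1ℚ
      w 1F = 1ℚ
      w 2F = fromℤ -[1+ 1 ]
      module _ (x : Fin 3 → H → ℚ) (sol : Solution V₃ x) where
        0≡1 : ∀ h → x 0F h + - x 1F h ≡ 0ℚ
        0≡1 = P-injective (λ h → x 0F h + - x 1F h) (λ h → +-cancel-≡ (trans (sol 0F h) (sym (sol 1F h)))
          (solve 5 (λ a b c d e → (a :+ :- c) :+ (b :+ :- d) := con 0ℚ :+ ((a :+ b :+ e) :+ :- (c :+ d :+ e))) refl
            (x 0F (U h)) (x 0F (U⁻ h)) (x 1F (U h)) (x 1F (U⁻ h)) (x 2F h)))
        x₁ : ∀ h → x 1F h ≡ x 0F h
        x₁ h = +-cancel-≡ (sym (0≡1 h)) (solve 2 (λ a b → b := a :+ (con 0ℚ :+ :- (a :+ :- b))) refl (x 0F h) (x 1F h))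
        x₂ : ∀ h → x 2F h ≡ - (x 0F (U h) + x 0F (U⁻ h))
        x₂ h = +-cancel-≡ (sol 0F h)
          (solve 3 (λ a b c → c := :- (a :+ b) :+ (a :+ b :+ c :+ :- con 0ℚ)) refl (x 0F (U h)) (x 0F (U⁻ h)) (x 2F h))
        eig : Eigen 1ℚ (x 0F)
        eig = P-2eS-kernel 1ℚ refl (x 0F) (λ h → +-cancel-≡ (sym (begin
          x 0F (S h) + x 0F (S h) + - (x 0F (U h) + x 0F (U⁻ h))
            ≡⟨ cong₂ (λ a b → x 0F (S h) + a + b) (x₁ (S h)) (x₂ h) ⟨
          x 0F (S h) + x 1F (S h) + x 2F h
            ≡⟨ cong (λ t → x 0F (S h) + x 1F (S h) + x 2F t) (SS h) ⟨
          x 0F (S h) + x 1F (S h) + x 2F (S (S h))  ≡⟨ sol 2F (S h) ⟩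
          0ℚ ∎))
          (solve 3 (λ s a b → a :+ b := con 2ℚ :* (con 1ℚ :* s) :+ (con 0ℚ :+ :- (s :+ s :+ :- (a :+ b)))) refl
            (x 0F (S h)) (x 0F (U h)) (x 0F (U⁻ h))))
        x≡ : ∀ i h → x i h ≡ w i * x 0F h
        x≡ 0F h = sym (ℚ.*-identityˡ (x 0F h))
        x≡ 1F h = trans (x₁ h) (sym (ℚ.*-identityˡ (x 0F h)))
        x≡ 2F h = trans (x₂ h) (trans (cong₂ (λ a b → - (a + b)) (eigen-U 1ℚ refl (x 0F) eig h) (eigen-U⁻ 1ℚ refl (x 0F) eig h))
          (solve 1 (λ a → :- (a :+ a) := con (fromℤ -[1+ 1 ]) :* a) refl (x 0F h)))

    nut₇ : Weighted.NutVoltage -1ℚ V₇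
    nut₇ = record
      { w = w ; w≢0 = from-yes (Fin.all? λ i → ¬? (w i ℚ.≟ 0ℚ)) ; w-top = λ ()
      ; balanced = from-yes (Fin.all? λ i → (weight w (nb₇ i 0F) + weight w (nb₇ i 1F) + weight w (nb₇ i 2F)) ℚ.≟ 0ℚ)
      ; unique = λ x sol → x 2F , eig x sol , x≡ x sol }
      where
      open Weighted -1ℚ
      -- The formulas for the orbits in terms of `X`, evaluated at `P = 2`, `S = -1`, `X = 1`.
      w : Fin 7 → ℚ
      w 0F = fromℤ -[1+ 1 ]
      w 1F = fromℤ (+ 4)
      w 2F = 1ℚ
      w 3F = 1ℚ
      w 4F = fromℤ -[1+ 2 ]
      w 5F = fromℤ -[1+ 1 ]
      w 6F = 1ℚ
      module _ (x : Fin 7 → H → ℚ) (sol : Solution V₇ x) where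
        X : H → ℚ
        X = x 2F
        x₃-S : ∀ h → x 3F (S h) ≡ X (S h)
        x₃-S h = +-cancel-≡ (trans (sol 3F h) (sym (sol 2F h)))
          (solve 4 (λ a b c d → d := c :+ (a :+ b :+ d :+ :- (a :+ b :+ c))) refl (x 1F h) (x 4F h) (X (S h)) (x 3F (S h)))
        x₃ : ∀ h → x 3F h ≡ X h
        x₃ h = trans (cong (x 3F) (sym (SS h))) (trans (x₃-S (S h)) (cong X (SS h)))
        x₀ : ∀ h → x 0F h ≡ - (X h + X h)
        x₀ h = +-cancel-≡ (trans (cong (λ t → x 0F h + X h + t) (sym (x₃ h))) (sol 1F h))
          (solve 2 (λ a b → a := :- (b :+ b) :+ (a :+ b :+ b :+ :- con 0ℚ)) refl (x 0F h) (X h))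
        x₅ : ∀ h → x 5F h ≡ - (X h + X h)
        x₅ h = +-cancel-≡ (trans (cong (λ t → X h + t + x 5F h) (sym (x₃ h))) (sol 4F h))
          (solve 2 (λ a b → a := :- (b :+ b) :+ (b :+ b :+ a :+ :- con 0ℚ)) refl (x 5F h) (X h))
        x₁ : ∀ h → x 1F h ≡ 2ℚ * (X (U h) + X (U⁻ h))
        x₁ h = +-cancel-≡ (trans (cong₂ (λ a b → a + b + x 1F h) (sym (x₀ (U h))) (sym (x₀ (U⁻ h)))) (sol 0F h))
          (solve 3 (λ a b c → c := con 2ℚ :* (a :+ b) :+ (:- (a :+ a) :+ :- (b :+ b) :+ c :+ :- con 0ℚ)) refl (X (U h)) (X (U⁻ h)) (x 1F h))
        x₄ : ∀ h → x 4F h ≡ - (2ℚ * (X (U h) + X (U⁻ h)) + X (S h))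
        x₄ h = +-cancel-≡ (trans (cong (λ a → a + x 4F h + X (S h)) (sym (x₁ h))) (sol 2F h))
          (solve 3 (λ a b c → c := :- (a :+ b) :+ (a :+ c :+ b :+ :- con 0ℚ)) refl (2ℚ * (X (U h) + X (U⁻ h))) (X (S h)) (x 4F h))
        x₆ : ∀ h → x 6F h ≡ 2ℚ * (X (U h) + X (U⁻ h)) + 3ℚ * X (S h)
        x₆ h = +-cancel-≡ (trans (cong₂ (λ a b → a + x 6F h + b) (sym (x₄ h)) (sym (x₅ (S h)))) (sol 5F h))
          (solve 3 (λ a b c → c := a :+ con 3ℚ :* b :+ (:- (a :+ b) :+ c :+ :- (b :+ b) :+ :- con 0ℚ)) refl
            (2ℚ * (X (U h) + X (U⁻ h))) (X (S h)) (x 6F h))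
        eig : Eigen -1ℚ X
        eig = quadratic-kernel X (λ h → trans
          (+-cancel-≡ (trans (sym (sol 6F h)) (cong (λ t → x 6F (U h) + x 6F (U⁻ h) + t) (x₅ h)))
            (solve 3 (λ a b c → con 2ℚ :* c := a :+ b :+ (con 0ℚ :+ :- (a :+ b :+ :- (c :+ c)))) refl (x 6F (U h)) (x 6F (U⁻ h)) (X h)))
          (cong₂ _+_ (x₆ (U h)) (x₆ (U⁻ h))))
        XS = eigen-S -1ℚ refl X eig
        XUU⁻ : ∀ h → X (U h) + X (U⁻ h) ≡ X h + X h
        XUU⁻ h = cong₂ _+_ (eigen-U -1ℚ refl X eig h) (eigen-U⁻ -1ℚ refl X eig h)
        x≡ : ∀ i h → x i h ≡ w i * X h
        x≡ 0F h = trans (x₀ h) (solve 1 (λ a → :- (a :+ a) := con (w 0F) :* a) refl (X h))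
        x≡ 1F h = trans (x₁ h) (trans (cong (2ℚ *_) (XUU⁻ h)) (solve 1 (λ a → con 2ℚ :* (a :+ a) := con (w 1F) :* a) refl (X h)))
        x≡ 2F h = sym (ℚ.*-identityˡ (X h))
        x≡ 3F h = trans (x₃ h) (sym (ℚ.*-identityˡ (X h)))
        x≡ 4F h = trans (x₄ h) (trans (cong₂ (λ a b → - (2ℚ * a + b)) (XUU⁻ h) (XS h))
          (solve 1 (λ a → :- (con 2ℚ :* (a :+ a) :+ con -1ℚ :* a) := con (w 4F) :* a) refl (X h)))
        x≡ 5F h = trans (x₅ h) (solve 1 (λ a → :- (a :+ a) := con (w 5F) :* a) refl (X h))
        x≡ 6F h = trans (x₆ h) (trans (cong₂ (λ a b → 2ℚ * a + 3ℚ * b) (XUU⁻ h) (XS h))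
          (solve 1 (λ a → con 2ℚ :* (a :+ a) :+ con 3ℚ :* (con -1ℚ :* a) := con (w 6F) :* a) refl (X h)))

    -- The path z - c - b - a, with voltages `flip` at b and c and a loop P at a.
    module Tail (a b c z : H → ℚ)
      (eqa : ∀ h → a (U h) + a (U⁻ h) + b h ≡ 0ℚ)
      (eqb : ∀ h → a h + b (S h) + c h ≡ 0ℚ)
      (eqc : ∀ h → b h + c (S h) + z h ≡ 0ℚ) where

      -- The equation of `b` at `S h` and that of `c` at `h` share the terms `b h + c (S h)`.
      a-S : ∀ h → a (S h) ≡ z h
      a-S h = +-cancel-≡ (trans (cong (λ t → a (S h) + b t + c (S h)) (sym (SS h))) (trans (eqb (S h)) (sym (eqc h))))
        (solve 4 (λ a b c z → a := z :+ (a :+ b :+ c :+ :- (b :+ c :+ z))) refl (a (S h)) (b h) (c (S h)) (z h))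

      tail-a : ∀ h → a h ≡ z (S h)
      tail-a h = trans (cong a (sym (SS h))) (a-S (S h))

      tail-b : ∀ h → b h ≡ - (z (S (U h)) + z (S (U⁻ h)))
      tail-b h = +-cancel-≡ (trans (cong₂ (λ s t → s + t + b h) (sym (tail-a (U h))) (sym (tail-a (U⁻ h)))) (eqa h))
        (solve 3 (λ s t b → b := :- (s :+ t) :+ (s :+ t :+ b :+ :- con 0ℚ)) refl (z (S (U h))) (z (S (U⁻ h))) (b h))

      tail-b-S : ∀ h → b (S h) ≡ - (z (U h) + z (U⁻ h))
      tail-b-S h = trans (tail-b (S h)) (cong₂ (λ s t → - (z s + z t))
        (trans (cong S (US h)) (SS (U h))) (trans (cong S (U⁻S h)) (SS (U⁻ h))))

      tail-c : ∀ h → c h ≡ z (U h) + z (U⁻ h) + - z (S h)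
      tail-c h = +-cancel-≡ (trans (cong₂ (λ s t → s + t + c h) (sym (tail-a h)) (sym (tail-b-S h))) (eqb h))
        (solve 3 (λ s t c → c := t :+ :- s :+ (s :+ :- t :+ c :+ :- con 0ℚ)) refl (z (S h)) (z (U h) + z (U⁻ h)) (c h))

    nut₁₁ : Weighted.NutVoltage -1ℚ V₁₁
    nut₁₁ = record
      { w = w ; w≢0 = from-yes (Fin.all? λ i → ¬? (w i ℚ.≟ 0ℚ)) ; w-top = λ ()
      ; balanced = from-yes (Fin.all? λ i → (weight w (nb₁₁ i 0F) + weight w (nb₁₁ i 1F) + weight w (nb₁₁ i 2F)) ℚ.≟ 0ℚ)
      ; unique = λ x sol → x 3F , eig x sol , x≡ x sol }
      where
      open Weighted -1ℚ
      w : Fin 11 → ℚ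
      w 0F = -1ℚ
      w 1F = 2ℚ
      w 2F = 3ℚ
      w 3F = 1ℚ
      w 4F = -1ℚ
      w 5F = 2ℚ
      w 6F = 3ℚ
      w 7F = fromℤ -[1+ 5 ]
      w 8F = fromℤ -[1+ 3 ]
      w 9F = 2ℚ
      w 10F = 3ℚ
      module _ (x : Fin 11 → H → ℚ) (sol : Solution V₁₁ x) where
        X u : H → ℚ
        X = x 3F
        u = x 9F
        module A = Tail (x 0F) (x 1F) (x 2F) X (sol 0F) (sol 1F) (sol 2F)
        module B = Tail (x 4F) (x 5F) (x 6F) X (sol 4F) (sol 5F) (sol 6F)
        x₇ : ∀ h → x 7F h ≡ - (2ℚ * (X (U h) + X (U⁻ h) + - X (S h)))
        x₇ h = +-cancel-≡ (trans (cong₂ (λ s t → s + t + x 7F h) (sym (A.tail-c h)) (sym (B.tail-c h))) (sol 3F h))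
          (solve 2 (λ s t → t := :- (con 2ℚ :* s) :+ (s :+ s :+ t :+ :- con 0ℚ)) refl (X (U h) + X (U⁻ h) + - X (S h)) (x 7F h))
        x₈ : ∀ h → x 8F h ≡ - (u (U h) + u (U⁻ h))
        x₈ h = +-cancel-≡ (sol 9F h)
          (solve 3 (λ a b c → c := :- (a :+ b) :+ (a :+ b :+ c :+ :- con 0ℚ)) refl (u (U h)) (u (U⁻ h)) (x 8F h))
        x₇′ : ∀ h → x 7F h ≡ u (S (U h)) + u (S (U⁻ h)) + - u h
        x₇′ h = +-cancel-≡ (trans (cong (λ t → u h + t + x 7F h)
            (sym (trans (x₈ (S h)) (cong₂ (λ s t → - (u s + u t)) (US h) (U⁻S h))))) (sol 8F h))
          (solve 3 (λ a b c → c := a :+ :- b :+ (b :+ :- a :+ c :+ :- con 0ℚ)) refl (u (S (U h)) + u (S (U⁻ h))) (u h) (x 7F h))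
        -- The two expressions for `x 7F` give `(SP - 1)u = -2(P - S)X`. As `SP - 1 = S(P - S)`,
        -- this is `(P - S)(Su + 2X) = 0`.
        y : H → ℚ
        y h = u (S h) + 2ℚ * X h
        y≡0 : ∀ h → y h ≡ 0ℚ
        y≡0 = P-S-injective y (λ h → +-cancel-≡ (trans (sym (x₇′ h)) (x₇ h)) (trans
          (solve 6 (λ a b c p q r → (a :+ con 2ℚ :* p) :+ (b :+ con 2ℚ :* q) :=
             (c :+ con 2ℚ :* r) :+ (a :+ b :+ :- c :+ :- (:- (con 2ℚ :* (p :+ q :+ :- r))))) refl
             (u (S (U h))) (u (S (U⁻ h))) (u h) (X (U h)) (X (U⁻ h)) (X (S h)))
          (cong (λ t → u t + 2ℚ * X (S h) + (u (S (U h)) + u (S (U⁻ h)) + - u h + - (- (2ℚ * (X (U h) + X (U⁻ h) + - X (S h))))))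
            (sym (SS h)))))
        x₉ : ∀ h → u h ≡ - (2ℚ * X (S h))
        x₉ h = +-cancel-≡ (trans (cong (λ t → u t + 2ℚ * X (S h)) (sym (SS h))) (y≡0 (S h)))
          (solve 2 (λ a b → a := :- b :+ (a :+ b :+ :- con 0ℚ)) refl (u h) (2ℚ * X (S h)))
        x₈′ : ∀ h → x 8F h ≡ 2ℚ * (X (S (U h)) + X (S (U⁻ h)))
        x₈′ h = trans (x₈ h) (trans (cong₂ (λ a b → - (a + b)) (x₉ (U h)) (x₉ (U⁻ h)))
          (solve 2 (λ a b → :- (:- (con 2ℚ :* a) :+ :- (con 2ℚ :* b)) := con 2ℚ :* (a :+ b)) refl (X (S (U h))) (X (S (U⁻ h)))))
        x₁₀ : ∀ h → x 10F h ≡ - (X h + 2ℚ * (X (S (U h)) + X (S (U⁻ h))))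
        x₁₀ h = +-cancel-≡ (trans (cong (λ t → X h + t + x 10F h) (sym (x₈′ h))) (sol 7F h))
          (solve 3 (λ a b c → c := :- (a :+ b) :+ (a :+ b :+ c :+ :- con 0ℚ)) refl (X h) (2ℚ * (X (S (U h)) + X (S (U⁻ h)))) (x 10F h))
        x₁₀-S : ∀ h → x 10F (S h) ≡ - (X (S h) + 2ℚ * (X (U h) + X (U⁻ h)))
        x₁₀-S h = trans (x₁₀ (S h)) (cong₂ (λ s t → - (X (S h) + 2ℚ * (X s + X t)))
          (trans (cong S (US h)) (SS (U h))) (trans (cong S (U⁻S h)) (SS (U⁻ h))))
        eig : Eigen -1ℚ X
        eig = quadratic-kernel X (λ h → +-cancel-≡ (trans (sym (cong₂ _+_
            (cong₂ _+_ (trans (cong (x 10F) (US h)) (x₁₀-S (U h))) (trans (cong (x 10F) (U⁻S h)) (x₁₀-S (U⁻ h))))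
            (trans (x₇ (S h)) (cong₂ (λ a b → - (2ℚ * (a + - X b))) (cong₂ (λ a b → X a + X b) (US h) (U⁻S h)) (SS h))))) (sol 10F (S h)))
          (solve 5 (λ x p q a b → con 2ℚ :* x := (con 2ℚ :* a :+ con 3ℚ :* p) :+ (con 2ℚ :* b :+ con 3ℚ :* q) :+
              (:- (p :+ con 2ℚ :* a) :+ :- (q :+ con 2ℚ :* b) :+ :- (con 2ℚ :* (p :+ q :+ :- x)) :+ :- con 0ℚ)) refl
            (X h) (X (S (U h))) (X (S (U⁻ h))) (X (U (U h)) + X (U⁻ (U h))) (X (U (U⁻ h)) + X (U⁻ (U⁻ h)))))
        XS = eigen-S -1ℚ refl X eig
        XUU⁻ : ∀ h → X (U h) + X (U⁻ h) ≡ X h + X h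
        XUU⁻ h = cong₂ _+_ (eigen-U -1ℚ refl X eig h) (eigen-U⁻ -1ℚ refl X eig h)
        XSUU⁻ : ∀ h → X (S (U h)) + X (S (U⁻ h)) ≡ -1ℚ * X h + -1ℚ * X h
        XSUU⁻ h = cong₂ _+_ (trans (XS (U h)) (cong (-1ℚ *_) (eigen-U -1ℚ refl X eig h)))
          (trans (XS (U⁻ h)) (cong (-1ℚ *_) (eigen-U⁻ -1ℚ refl X eig h)))
        tail₁ : ∀ h → - (X (S (U h)) + X (S (U⁻ h))) ≡ 2ℚ * X h
        tail₁ h = trans (cong -_ (XSUU⁻ h)) (solve 1 (λ a → :- (con -1ℚ :* a :+ con -1ℚ :* a) := con 2ℚ :* a) refl (X h))
        tail₂ : ∀ h → X (U h) + X (U⁻ h) + - X (S h) ≡ 3ℚ * X h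
        tail₂ h = trans (cong₂ (λ a b → a + - b) (XUU⁻ h) (XS h))
          (solve 1 (λ a → a :+ a :+ :- (con -1ℚ :* a) := con 3ℚ :* a) refl (X h))
        x≡ : ∀ i h → x i h ≡ w i * X h
        x≡ 0F h = trans (A.tail-a h) (XS h)
        x≡ 1F h = trans (A.tail-b h) (tail₁ h)
        x≡ 2F h = trans (A.tail-c h) (tail₂ h)
        x≡ 3F h = sym (ℚ.*-identityˡ (X h))
        x≡ 4F h = trans (B.tail-a h) (XS h)
        x≡ 5F h = trans (B.tail-b h) (tail₁ h)
        x≡ 6F h = trans (B.tail-c h) (tail₂ h)
        x≡ 7F h = trans (x₇ h) (trans (cong (λ t → - (2ℚ * t)) (tail₂ h))
          (solve 1 (λ a → :- (con 2ℚ :* (con 3ℚ :* a)) := con (w 7F) :* a) refl (X h)))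
        x≡ 8F h = trans (x₈′ h) (trans (cong (2ℚ *_) (XSUU⁻ h))
          (solve 1 (λ a → con 2ℚ :* (con -1ℚ :* a :+ con -1ℚ :* a) := con (w 8F) :* a) refl (X h)))
        x≡ 9F h = trans (x₉ h) (trans (cong (λ t → - (2ℚ * t)) (XS h))
          (solve 1 (λ a → :- (con 2ℚ :* (con -1ℚ :* a)) := con 2ℚ :* a) refl (X h)))
        x≡ 10F h = trans (x₁₀ h) (trans (cong (λ t → - (X h + 2ℚ * t)) (XSUU⁻ h))
          (solve 1 (λ a → :- (a :+ con 2ℚ :* (con -1ℚ :* a :+ con -1ℚ :* a)) := con 3ℚ :* a) refl (X h)))

  -- Cubic graphs from neighbour functions.

  module _ {n : ℕ} (N : Fin n → Fin 3 → Fin n) (N-inj : ∀ u → Injective _≡_ _≡_ (N u))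
           (N-sym : ∀ u k → ∃ λ l → N (N u k) l ≡ u) (N-irr : ∀ u k → N u k ≢ u) where

    adjacent? : ∀ u v → Dec (∃ λ k → N u k ≡ v)
    adjacent? u v = Fin.any? (λ k → N u k Fin.≟ v)

    private
      swap : ∀ u v → (∃ λ k → N u k ≡ v) → ∃ λ k → N v k ≡ u
      swap u v (k , refl) = N-sym u k

    cubicGraph : Graph n
    cubicGraph = record
      { adj    = λ u v → does (adjacent? u v)
      ; sym    = λ u v → does-⇔ (mk⇔ (swap u v) (swap v u)) (adjacent? u v) (adjacent? v u)
      ; irrefl = λ u → dec-false (adjacent? u u) (uncurry (N-irr u))
      }

    cubicGraph-cubic : Cubic cubicGraph
    cubicGraph-cubic u = trans (sumℕ≡sum n _) (ImageSum.image-sum ℕ.+-0-commutativeMonoid (N u) (N-inj u) (λ _ → 1))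

    cubicGraph-A· : ∀ x u → (A· cubicGraph) x u ≡ x (N u 0F) + x (N u 1F) + x (N u 2F)
    cubicGraph-A· x u = begin
      sumℚ n (λ j → A[ cubicGraph ] u j * x j)                              ≡⟨ sumℚ≡sum n _ ⟩
      SumℚM.sum (λ j → A[ cubicGraph ] u j * x j)                           ≡⟨ SumℚM.sum-cong-≗ entry ⟩
      SumℚM.sum (λ j → if does (adjacent? u j) then x j else 0ℚ)            ≡⟨ ImageSum.image-sum ℚ.+-0-commutativeMonoid (N u) (N-inj u) x ⟩
      x (N u 0F) + (x (N u 1F) + (x (N u 2F) + 0ℚ))
        ≡⟨ solve 3 (λ a b c → a :+ (b :+ (c :+ con 0ℚ)) := a :+ b :+ c) refl (x (N u 0F)) (x (N u 1F)) (x (N u 2F)) ⟩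
      x (N u 0F) + x (N u 1F) + x (N u 2F)                                  ∎
      where
      open ≡-Reasoning
      entry : ∀ j → A[ cubicGraph ] u j * x j ≡ (if does (adjacent? u j) then x j else 0ℚ)
      entry j with does (adjacent? u j)
      ... | true  = ℚ.*-identityˡ (x j)
      ... | false = ℚ.*-zeroˡ (x j)

  -- The derived graph of a voltage graph.

  module Realization (k : ℕ) where
    open Cyclic k
    open Kernel k

    amount : Shift → ℕ
    amount stay = 0
    amount flip = N
    amount up   = 2
    amount down = 8 ℕ.+ k ℕ.* 12

    move≡act : ∀ s h → move s h ≡ act (amount s) h
    move≡act stay h = sym (act-0 h)
    move≡act flip h = refl
    move≡act up   h = refl
    move≡act down h = refl

    amount<m : ∀ s → amount s ℕ.< m
    amount<m stay = ℕ.s≤s ℕ.z≤n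
    amount<m flip = subst (N ℕ.<_) N+N≡m (ℕ.m<m+n N (ℕ.s≤s ℕ.z≤n))
    amount<m up   = ℕ.s≤s (ℕ.s≤s (ℕ.s≤s ℕ.z≤n))
    amount<m down = ℕ.n≤1+n (9 ℕ.+ k ℕ.* 12)

    -- Separates the one pair of amounts that unification does not tell apart.
    N<down : N ℕ.< amount down
    N<down = ℕ.+-mono-≤ (ℕ.m≤m+n 6 2) (ℕ.*-monoʳ-≤ k (ℕ.m≤m+n 6 6))

    amount-injective : ∀ s t → amount s ≡ amount t → s ≡ t
    amount-injective stay stay _  = refl
    amount-injective flip flip _  = refl
    amount-injective flip down eq = contradiction eq (ℕ.<⇒≢ N<down)
    amount-injective up   up   _  = refl
    amount-injective down flip eq = contradiction (sym eq) (ℕ.<⇒≢ N<down)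
    amount-injective down down _  = refl

    -- If `h + a` stays below `m`, a fixed point forces `a = 0`; if it wraps around, which happens
    -- at most once, `a = m`.
    act-free : ∀ a h → 0 ℕ.< a → a ℕ.< m → act a h ≢ h
    act-free a h 0<a a<m eq with toℕ h ℕ.+ a ℕ.<? m
    ... | yes lt = contradiction (ℕ.+-cancelˡ-≡ (toℕ h) a 0 (trans (trans (sym (ℕ.m<n⇒m%n≡m lt)) eqℕ) (sym (ℕ.+-identityʳ (toℕ h))))) (ℕ.n>0⇒n≢0 0<a)
      where
      eqℕ : (toℕ h ℕ.+ a) ℕ.% m ≡ toℕ h
      eqℕ = trans (sym (toℕ-act a h)) (cong toℕ eq)
    ... | no ≮ = contradiction (ℕ.+-cancelˡ-≡ (toℕ h) a m (begin
        toℕ h ℕ.+ a                    ≡⟨ ℕ.m∸n+n≡m m≤ ⟨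
        toℕ h ℕ.+ a ℕ.∸ m ℕ.+ m        ≡⟨ cong (ℕ._+ m) h≡ ⟨
        toℕ h ℕ.+ m                    ∎)) (ℕ.<⇒≢ a<m)
      where
      open ≡-Reasoning
      m≤ : m ℕ.≤ toℕ h ℕ.+ a
      m≤ = ℕ.≮⇒≥ ≮
      small : toℕ h ℕ.+ a ℕ.∸ m ℕ.< m
      small = ℕ.+-cancelʳ-< m (toℕ h ℕ.+ a ℕ.∸ m) m
        (subst (ℕ._< m ℕ.+ m) (sym (ℕ.m∸n+n≡m m≤)) (ℕ.+-mono-< (Fin.toℕ<n h) a<m))
      h≡ : toℕ h ≡ toℕ h ℕ.+ a ℕ.∸ m
      h≡ = begin
        toℕ h                          ≡⟨ cong toℕ eq ⟨
        toℕ (act a h)                  ≡⟨ toℕ-act a h ⟩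
        (toℕ h ℕ.+ a) ℕ.% m            ≡⟨ ℕ.m≤n⇒[n∸m]%m≡n%m m≤ ⟨
        (toℕ h ℕ.+ a ℕ.∸ m) ℕ.% m      ≡⟨ ℕ.m<n⇒m%n≡m small ⟩
        toℕ h ℕ.+ a ℕ.∸ m              ∎

    act-separates : ∀ {a b} h → a ℕ.< b → b ℕ.< m → act a h ≢ act b h
    act-separates {a} {b} h a<b b<m eq = act-free (b ℕ.∸ a) (act a h) (ℕ.m<n⇒0<n∸m a<b)
      (ℕ.≤-<-trans (ℕ.m∸n≤m b a) b<m)
      (trans (act-act (b ℕ.∸ a) a h) (trans (cong (λ t → act t h) (ℕ.m+[n∸m]≡n (ℕ.<⇒≤ a<b))) (sym eq)))

    -- The voltages are distinct elements of a freely acting group. This is what lets `simple` and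
    -- `loopless` exclude multiple edges and loops in the derived graph.
    move-injective : ∀ s t h → move s h ≡ move t h → s ≡ t
    move-injective s t h eq with ℕ.<-cmp (amount s) (amount t)
    ... | tri< lt _ _ = contradiction (trans (sym (move≡act s h)) (trans eq (move≡act t h))) (act-separates h lt (amount<m t))
    ... | tri≈ _ e _  = amount-injective s t e
    ... | tri> _ _ gt = contradiction (trans (sym (move≡act t h)) (trans (sym eq) (move≡act s h))) (act-separates h gt (amount<m s))

    move-inverse : ∀ s h → move (inverse s) (move s h) ≡ h
    move-inverse stay h = refl
    move-inverse flip h = SS h
    move-inverse up   h = U⁻U h
    move-inverse down h = UU⁻ h

    move-act : ∀ s a h → move s (act a h) ≡ act a (move s h)
    move-act s a h = trans (move≡act s (act a h)) (trans (act-comm (amount s) a h) (cong (act a) (sym (move≡act s h))))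

    module _ {n : ℕ} (V : Voltage n) where
      open Voltage V

      Vertex : Set
      Vertex = Fin (suc n ℕ.* m)

      encode : Fin (suc n) → H → Vertex
      encode = combine

      orbit : Vertex → Fin (suc n)
      orbit u = proj₁ (remQuot m u)

      place : Vertex → H
      place u = proj₂ (remQuot {suc n} m u)

      follow : Dart (suc n) → H → Vertex
      follow (j , _ , s) h = encode j (move s h)

      next : Vertex → Fin 3 → Vertex
      next u k = follow (nb (orbit u) k) (place u)

      decode : ∀ u → encode (orbit u) (place u) ≡ u
      decode = Fin.combine-remQuot {suc n} m

      orbit-encode : ∀ i h → orbit (encode i h) ≡ i
      orbit-encode i h = cong proj₁ (Fin.remQuot-combine i h)

      place-encode : ∀ i h → place (encode i h) ≡ h
      place-encode i h = cong proj₂ (Fin.remQuot-combine i h)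

      next-encode : ∀ i h k → next (encode i h) k ≡ follow (nb i k) h
      next-encode i h k = cong₂ (λ j → follow (nb j k)) (orbit-encode i h) (place-encode i h)

      next-injective : ∀ u → Injective _≡_ _≡_ (next u)
      next-injective u {a} {b} eq with nb (orbit u) a in eqa | nb (orbit u) b in eqb
      ... | j , l , s | j′ , l′ , s′ with Fin.combine-injective j (move s (place u)) j′ (move s′ (place u)) eq
      ... | refl , eq′ with refl ← move-injective s s′ (place u) eq′ = simple eqa eqb

      next-symmetric : ∀ u k → ∃ λ l → next (next u k) l ≡ u
      next-symmetric u k with nb (orbit u) k in eq
      ... | j , l , s = l , (begin
        next (encode j (move s (place u))) l                      ≡⟨ next-encode j (move s (place u)) l ⟩
        follow (nb j l) (move s (place u))                        ≡⟨ cong (λ d → follow d (move s (place u))) (mate eq) ⟩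
        encode (orbit u) (move (inverse s) (move s (place u)))    ≡⟨ cong (encode (orbit u)) (move-inverse s (place u)) ⟩
        encode (orbit u) (place u)                                ≡⟨ decode u ⟩
        u                                                         ∎)
        where open ≡-Reasoning

      next-irreflexive : ∀ u k → next u k ≢ u
      next-irreflexive u k eq with nb (orbit u) k in eqk
      ... | j , l , s with Fin.combine-injective j (move s (place u)) (orbit u) (place u) (trans eq (sym (decode u)))
      ... | refl , eq′ with refl ← move-injective s stay (place u) eq′ = loopless eqk

      graph : Graph (suc n ℕ.* m)
      graph = cubicGraph next next-injective next-symmetric next-irreflexive

      rotate : ℕ → Vertex → Vertex
      rotate a u = encode (orbit u) (act a (place u))

      rotate-encode : ∀ a i h → rotate a (encode i h) ≡ encode i (act a h)
      rotate-encode a i h = cong₂ (λ j t → encode j (act a t)) (orbit-encode i h) (place-encode i h)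

      rotate-rotate : ∀ a b u → rotate a (rotate b u) ≡ rotate (b ℕ.+ a) u
      rotate-rotate a b u = trans (rotate-encode a (orbit u) (act b (place u))) (cong (encode (orbit u)) (act-act a b (place u)))

      rotate-m : ∀ u → rotate m u ≡ u
      rotate-m u = trans (cong (encode (orbit u)) (act-m (place u))) (decode u)

      next-rotate : ∀ a u k → next (rotate a u) k ≡ rotate a (next u k)
      next-rotate a u k with nb (orbit u) k in eq
      ... | j , l , s = begin
        next (encode (orbit u) (act a (place u))) k  ≡⟨ next-encode (orbit u) (act a (place u)) k ⟩
        follow (nb (orbit u) k) (act a (place u))    ≡⟨ cong (λ d → follow d (act a (place u))) eq ⟩
        encode j (move s (act a (place u)))          ≡⟨ cong (encode j) (move-act s a (place u)) ⟩
        encode j (act a (move s (place u)))          ≡⟨ rotate-encode a j (move s (place u)) ⟨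
        rotate a (encode j (move s (place u)))       ∎
        where open ≡-Reasoning

      rotation : Fin (suc n ℕ.* m) ↔ Fin (suc n ℕ.* m)
      -- The inverse rotation is by `m - 1 = 9 + 12k`.
      rotation = mk↔ₛ′ (rotate 1) (rotate (9 ℕ.+ k ℕ.* 12))
        (λ u → trans (rotate-rotate 1 (9 ℕ.+ k ℕ.* 12) u) (trans (cong (λ t → rotate t u) (ℕ.+-comm (9 ℕ.+ k ℕ.* 12) 1)) (rotate-m u)))
        (λ u → trans (rotate-rotate (9 ℕ.+ k ℕ.* 12) 1 u) (rotate-m u))

      iter-rotate : ∀ a u → iter a (rotate 1) u ≡ rotate a u
      iter-rotate zero    u = sym (trans (cong (encode (orbit u)) (act-0 (place u))) (decode u))
      iter-rotate (suc a) u = trans (cong (rotate 1) (iter-rotate a u))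
        (trans (rotate-rotate 1 a u) (cong (λ t → rotate t u) (ℕ.+-comm a 1)))

      rotation-automorphism : IsAutomorphism graph rotation
      rotation-automorphism u v = does-⇔ (mk⇔
          (λ (k , eq) → k , ↔-injective rotation (trans (sym (next-rotate 1 u k)) eq))
          (λ (k , eq) → k , trans (next-rotate 1 u k) (cong (rotate 1) eq)))
        (adjacent? next next-injective next-symmetric next-irreflexive (rotate 1 u) (rotate 1 v))
        (adjacent? next next-injective next-symmetric next-irreflexive u v)

      graph-circulant : Circulant (suc n) graph
      graph-circulant = rotation , rotation-automorphism , m , ℕ.s≤s ℕ.z≤n , refl , λ u →
        trans (iter-rotate m u) (rotate-m u) ,
        λ a 0<a a<m eq → act-free a (place u) 0<a a<m
          (proj₂ (Fin.combine-injective (orbit u) (act a (place u)) (orbit u) (place u)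
            (trans (sym (iter-rotate a u)) (trans eq (sym (decode u))))))

      module _ (e : ℚ) (ee : e * e ≡ 1ℚ) (ν : Weighted.NutVoltage e V) where
        open Weighted e
        open NutVoltage ν

        kernelVector : Vertex → ℚ
        kernelVector u = w (orbit u) * χ e ee (place u)

        χ-move : ∀ s h → χ e ee (move s h) ≡ sign s * χ e ee h
        χ-move stay h = sym (ℚ.*-identityˡ (χ e ee h))
        χ-move flip h = eigen-S e ee (χ e ee) (χ-eigen e ee) h
        χ-move up   h = trans (eigen-U e ee (χ e ee) (χ-eigen e ee) h) (sym (ℚ.*-identityˡ (χ e ee h)))
        χ-move down h = trans (eigen-U⁻ e ee (χ e ee) (χ-eigen e ee) h) (sym (ℚ.*-identityˡ (χ e ee h)))

        kernelVector-follow : ∀ d h → kernelVector (follow d h) ≡ weight w d * χ e ee h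
        kernelVector-follow (j , l , s) h = begin
          w (orbit (encode j (move s h))) * χ e ee (place (encode j (move s h)))
            ≡⟨ cong₂ (λ a b → w a * χ e ee b) (orbit-encode j (move s h)) (place-encode j (move s h)) ⟩
          w j * χ e ee (move s h)        ≡⟨ cong (w j *_) (χ-move s h) ⟩
          w j * (sign s * χ e ee h)      ≡⟨ solve 3 (λ a b c → a :* (b :* c) := b :* a :* c) refl (w j) (sign s) (χ e ee h) ⟩
          sign s * w j * χ e ee h        ∎
          where open ≡-Reasoning

        graph-nut : Nut graph
        graph-nut = ℕ.s≤s (ℕ.s≤s ℕ.z≤n) , kernelVector , nonzero , inKernel , spans
          where
          open ≡-Reasoning
          χ≢0 : ∀ h → χ e ee h ≢ 0ℚ
          χ≢0 h eq = contradiction (trans (sym (χ-χ≡1 e ee h)) (trans (cong (_* χ e ee h) eq) (ℚ.*-zeroˡ (χ e ee h)))) λ ()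
          nonzero : ∀ u → kernelVector u ≢ 0ℚ
          nonzero u eq = χ≢0 (place u) (*-cancelˡ-0 (w≢0 (orbit u)) eq)
          inKernel : InKernel graph kernelVector
          inKernel u = begin
            (A· graph) kernelVector u
              ≡⟨ cubicGraph-A· next next-injective next-symmetric next-irreflexive kernelVector u ⟩
            kernelVector (next u 0F) + kernelVector (next u 1F) + kernelVector (next u 2F)
              ≡⟨ cong₂ _+_ (cong₂ _+_ (kernelVector-follow (nb i 0F) h) (kernelVector-follow (nb i 1F) h)) (kernelVector-follow (nb i 2F) h) ⟩
            weight w (nb i 0F) * χ e ee h + weight w (nb i 1F) * χ e ee h + weight w (nb i 2F) * χ e ee h
              ≡⟨ solve 4 (λ a b c d → a :* d :+ b :* d :+ c :* d := (a :+ b :+ c) :* d) refl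
                   (weight w (nb i 0F)) (weight w (nb i 1F)) (weight w (nb i 2F)) (χ e ee h) ⟩
            (weight w (nb i 0F) + weight w (nb i 1F) + weight w (nb i 2F)) * χ e ee h
              ≡⟨ cong (_* χ e ee h) (balanced i) ⟩
            0ℚ * χ e ee h  ≡⟨ ℚ.*-zeroˡ (χ e ee h) ⟩
            0ℚ             ∎
            where
            i = orbit u
            h = place u
          spans : ∀ y → InKernel graph y → ∃ λ c → ∀ u → y u ≡ c * kernelVector u
          -- An eigenfunction `f` is `f zero` times `χ`.
          spans y ker = f zero , λ u → begin
            y u                                       ≡⟨ cong y (decode u) ⟨
            y (encode (orbit u) (place u))            ≡⟨ y≡ (orbit u) (place u) ⟩
            w (orbit u) * f (place u)                 ≡⟨ cong (w (orbit u) *_) (eigen⇒χ e ee f f-eigen (place u)) ⟩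
            w (orbit u) * (f zero * χ e ee (place u)) ≡⟨ solve 3 (λ a b c → a :* (b :* c) := b :* (a :* c)) refl (w (orbit u)) (f zero) (χ e ee (place u)) ⟩
            f zero * kernelVector u                   ∎
            where
            x : Fin (suc n) → H → ℚ
            x i h = y (encode i h)
            sol : Solution V x
            sol i h = begin
              y (follow (nb i 0F) h) + y (follow (nb i 1F) h) + y (follow (nb i 2F) h)
                ≡⟨ cong₂ _+_ (cong₂ _+_ (cong y (next-encode i h 0F)) (cong y (next-encode i h 1F))) (cong y (next-encode i h 2F)) ⟨
              y (next (encode i h) 0F) + y (next (encode i h) 1F) + y (next (encode i h) 2F)
                ≡⟨ cubicGraph-A· next next-injective next-symmetric next-irreflexive y (encode i h) ⟨
              (A· graph) y (encode i h)  ≡⟨ ker (encode i h) ⟩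
              0ℚ                         ∎
            f       = proj₁ (unique x sol)
            f-eigen = proj₁ (proj₂ (unique x sol))
            y≡      = proj₂ (proj₂ (unique x sol))

        graph-cubicCirculantNut : CubicCirculantNut (suc n) (suc n ℕ.* m , graph)
        graph-cubicCirculantNut =
          cubicGraph-cubic next next-injective next-symmetric next-irreflexive , graph-circulant , graph-nut

  -- From the three bases to all numbers of orbits.

  record Family (n : ℕ) : Set where
    field
      e   : ℚ
      ee  : e * e ≡ 1ℚ
      V   : Voltage n
      nut : ∀ k → Kernel.Weighted.NutVoltage k e V

  extendFamily : ∀ {n} → Family n → Family (3 ℕ.+ n)
  extendFamily F = record
    { e = e ; ee = ee ; V = Extension.extend V
    ; nut = λ k → Kernel.Weighted.extend-nut k e ee V (nut k) }
    where open Family F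

  family₃ : Family 2
  family₃ = record { e = 1ℚ ; ee = refl ; V = V₃ ; nut = Bases.nut₃ }

  family₇ : Family 6
  family₇ = record { e = -1ℚ ; ee = refl ; V = V₇ ; nut = Bases.nut₇ }

  family₁₁ : Family 10
  family₁₁ = record { e = -1ℚ ; ee = refl ; V = V₁₁ ; nut = Bases.nut₁₁ }

  -- `Family n` has `suc n` orbits, so the base cases are `9 = 3 + 3 + 3`, `10 = 7 + 3` and 11, one
  -- for each residue modulo 3.
  family≥9 : ∀ d → Family (8 ℕ.+ d)
  family≥9 0 = extendFamily (extendFamily family₃)
  family≥9 1 = extendFamily family₇
  family≥9 2 = family₁₁
  family≥9 (suc (suc (suc d))) = extendFamily (family≥9 d)

  InfinitelyMany : ℕ → Set
  InfinitelyMany ℓ = Σ (ℕ → AnyGraph) λ F → (∀ k → CubicCirculantNut ℓ (F k)) × (∀ i j → i ≢ j → ¬ IsoAny (F i) (F j))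

  infinitelyMany : ∀ {n} → Family n → InfinitelyMany (suc n)
  infinitelyMany {n} 𝓕 = (λ k → suc n ℕ.* Cyclic.m k , Realization.graph k V) ,
    (λ k → Realization.graph-cubicCirculantNut k V e ee (nut k)) ,
    -- Isomorphic graphs have equally many vertices, and `suc n * (10 + 12k)` determines `k`.
    λ i j i≢j (π , _) → i≢j (ℕ.*-cancelʳ-≡ i j 12 (ℕ.+-cancelˡ-≡ 10 (i ℕ.* 12) (j ℕ.* 12)
      (ℕ.*-cancelˡ-≡ (Cyclic.m i) (Cyclic.m j) (suc n) (↔⇒≡ π))))
    where open Family 𝓕

  existence : ∀ ℓ → ℓ ≡ 3 ⊎ ℓ ≡ 6 ⊎ ℓ ≡ 7 ⊎ 9 ≤ ℓ → InfinitelyMany ℓ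
  existence ℓ (inj₁ refl)               = infinitelyMany family₃
  existence ℓ (inj₂ (inj₁ refl))        = infinitelyMany (extendFamily family₃)
  existence ℓ (inj₂ (inj₂ (inj₁ refl))) = infinitelyMany family₇
  existence ℓ (inj₂ (inj₂ (inj₂ 9≤ℓ)))
    with d , refl ← ℕ.m≤n⇒∃[o]m+o≡n 9≤ℓ = infinitelyMany (family≥9 d)

-- Nonexistence: the finite search for balanced symmetric matrices.

module Nonexistence where

  open import Data.Integer using (_+_; _*_; sign)

  module Search where
    open ℤSolver.+-*-Solver using (solve; _:=_; _:+_; _:*_)

    Row : ℕ → Set
    Row = Vec ℤ

    dot : ∀ {n} → Row n → (Fin n → ℤ) → ℤ
    dot []      y = + 0
    dot (a ∷ r) y = a * y zero + dot r (y ∘ suc)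

    total : ∀ {n} → Row n → ℤ
    total []      = + 0
    total (a ∷ r) = a + total r

    -- Suffix sums are the coefficients of `dot r y` with respect to the increments of `y`, which
    -- are nonnegative for ascending `y`.
    suffixes≥0 : ∀ {n} → Row n → Bool
    suffixes≥0 []      = true
    suffixes≥0 (a ∷ r) = suffixes≥0 r ∧ ⌊ + 0 ℤ.≤? total (a ∷ r) ⌋

    positive : ∀ {n} → Row n → Bool
    positive r = ⌊ + 0 ℤ.<? total r ⌋ ∧ suffixes≥0 r

    scale : ∀ {n} → ℤ → Row n → Row n
    scale c = Vec.map (c *_)

    infixl 6 _⊞_
    _⊞_ : ∀ {n} → Row n → Row n → Row n
    _⊞_ = zipWith _+_

    dot-⊞ : ∀ {n} (r s : Row n) y → dot (r ⊞ s) y ≡ dot r y + dot s y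
    dot-⊞ []      []      y = refl
    dot-⊞ (a ∷ r) (b ∷ s) y = trans (cong (λ z → (a + b) * y zero + z) (dot-⊞ r s (y ∘ suc)))
      (solve 5 (λ a b y r s → (a :+ b) :* y :+ (r :+ s) := a :* y :+ r :+ (b :* y :+ s)) refl
        a b (y zero) (dot r (y ∘ suc)) (dot s (y ∘ suc)))

    dot-scale : ∀ {n} c (r : Row n) y → dot (scale c r) y ≡ c * dot r y
    dot-scale c []      y = sym (ℤ.*-zeroʳ c)
    dot-scale c (a ∷ r) y = trans (cong (λ z → c * a * y zero + z) (dot-scale c r (y ∘ suc)))
      (solve 4 (λ c a y r → c :* a :* y :+ c :* r := c :* (a :* y :+ r)) refl c a (y zero) (dot r (y ∘ suc)))

    Ascending : ∀ {n} → (Fin n → ℤ) → Set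
    Ascending y = ∀ i j → i Fin.≤ j → y i ℤ.≤ y j

    -- Abel summation.
    dot-lower : ∀ {n} (r : Row n) y b → Ascending y → (∀ i → b ℤ.≤ y i) → T (suffixes≥0 r) → total r * b ℤ.≤ dot r y
    dot-lower []      y b asc b≤ ok = ℤ.≤-refl
    dot-lower (a ∷ r) y b asc b≤ ok = begin
      total (a ∷ r) * b                ≤⟨ ℤ.*-monoˡ-≤-nonNeg (total (a ∷ r)) (b≤ zero) ⟩
      total (a ∷ r) * y zero           ≡⟨ ℤ.*-distribʳ-+ (y zero) a (total r) ⟩
      a * y zero + total r * y zero    ≤⟨ ℤ.+-monoʳ-≤ (a * y zero) (dot-lower r (y ∘ suc) (y zero)
                                            (λ i j i≤j → asc (suc i) (suc j) (ℕ.s≤s i≤j)) (λ i → asc zero (suc i) ℕ.z≤n) (proj₁ oks)) ⟩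
      a * y zero + dot r (y ∘ suc)     ∎
      where
      open ℤ.≤-Reasoning
      oks = Equivalence.to T-∧ ok
      instance _ = ℤ.nonNegative (toWitness {a? = + 0 ℤ.≤? total (a ∷ r)} (proj₂ oks))

    positive⇒dot≢0 : ∀ {n} (r : Row n) y → Ascending y → (∀ i → + 1 ℤ.≤ y i) → T (positive r) → dot r y ≢ + 0
    positive⇒dot≢0 r y asc 1≤y ok eq = ℤ.<-irrefl refl (begin-strict
      + 0            <⟨ toWitness {a? = + 0 ℤ.<? total r} (proj₁ oks) ⟩
      total r        ≡⟨ ℤ.*-identityʳ (total r) ⟨
      total r * + 1  ≤⟨ dot-lower r y (+ 1) asc 1≤y (proj₂ oks) ⟩
      dot r y        ≡⟨ eq ⟩
      + 0            ∎)
      where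
      open ℤ.≤-Reasoning
      oks = Equivalence.to (T-∧ {⌊ + 0 ℤ.<? total r ⌋}) ok

    refuted : ∀ {n} → Row n → Bool
    refuted r = positive r ∨ positive (scale -[1+ 0 ] r)

    refuted⇒dot≢0 : ∀ {n} (r : Row n) y → Ascending y → (∀ i → + 1 ℤ.≤ y i) → T (refuted r) → dot r y ≢ + 0
    refuted⇒dot≢0 r y asc 1≤y ok eq = [ (λ p → positive⇒dot≢0 r y asc 1≤y p eq)
      , (λ p → positive⇒dot≢0 (scale -[1+ 0 ] r) y asc 1≤y p (trans (dot-scale -[1+ 0 ] r y) (trans (cong (-[1+ 0 ] *_) eq) refl))) ]′
      (Equivalence.to (T-∨ {positive r}) ok)

    ⟪_⟫ : Sign → ℤ
    ⟪ s ⟫ = s ℤ.◃ 1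

    SignedIndex : ℕ → Set
    SignedIndex ℓ = Fin ℓ × Sign

    coeff : ∀ {ℓ} → SignedIndex ℓ → Fin ℓ → ℤ
    coeff (i , s) j = if does (i Fin.≟ j) then ⟪ s ⟫ else + 0

    unit : ∀ {ℓ} → SignedIndex ℓ → Row ℓ
    unit p = tabulate (coeff p)

    row : ∀ {ℓ} → (Fin 3 → SignedIndex ℓ) → Row ℓ
    row t = unit (t 0F) ⊞ unit (t 1F) ⊞ unit (t 2F)

    entry : ∀ {ℓ} → (Fin 3 → SignedIndex ℓ) → Fin ℓ → ℤ
    entry t j = coeff (t 0F) j + coeff (t 1F) j + coeff (t 2F) j

    lookup-row : ∀ {ℓ} (t : Fin 3 → SignedIndex ℓ) j → lookup (row t) j ≡ entry t j
    lookup-row t j = trans (Vec.lookup-zipWith _+_ j (unit (t 0F) ⊞ unit (t 1F)) (unit (t 2F)))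
      (cong₂ _+_ (trans (Vec.lookup-zipWith _+_ j (unit (t 0F)) (unit (t 1F)))
        (cong₂ _+_ (Vec.lookup∘tabulate (coeff (t 0F)) j) (Vec.lookup∘tabulate (coeff (t 1F)) j)))
        (Vec.lookup∘tabulate (coeff (t 2F)) j))

    dot-0 : ∀ {n} (y : Fin n → ℤ) → dot (tabulate (λ _ → + 0)) y ≡ + 0
    dot-0 {zero}  y = refl
    dot-0 {suc n} y = trans (ℤ.+-identityˡ _) (dot-0 (y ∘ suc))

    dot-unit : ∀ {ℓ} (p : SignedIndex ℓ) y → dot (unit p) y ≡ ⟪ proj₂ p ⟫ * y (proj₁ p)
    dot-unit (zero  , s) y = trans (cong (λ z → ⟪ s ⟫ * y zero + z) (dot-0 (y ∘ suc))) (ℤ.+-identityʳ _)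
    dot-unit (suc i , s) y = trans (ℤ.+-identityˡ _) (dot-unit (i , s) (y ∘ suc))

    balance : ∀ {ℓ} → (Fin 3 → SignedIndex ℓ) → (Fin ℓ → ℤ) → ℤ
    balance t y = term 0F + term 1F + term 2F
      where
      term : Fin 3 → ℤ
      term k = ⟪ proj₂ (t k) ⟫ * y (proj₁ (t k))

    dot-row : ∀ {ℓ} (t : Fin 3 → SignedIndex ℓ) y → dot (row t) y ≡ balance t y
    dot-row t y = trans (dot-⊞ (unit (t 0F) ⊞ unit (t 1F)) (unit (t 2F)) y)
      (cong₂ _+_ (trans (dot-⊞ (unit (t 0F)) (unit (t 1F)) y) (cong₂ _+_ (dot-unit (t 0F) y) (dot-unit (t 1F) y))) (dot-unit (t 2F) y))

    signs : List Sign
    signs = Sign.+ ∷ Sign.- ∷ []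

    signedIndices : ∀ ℓ → List (SignedIndex ℓ)
    signedIndices ℓ = concatMap (λ i → List.map (i ,_) signs) (allFin ℓ)

    triple : ∀ {A : Set} → A → A → A → Fin 3 → A
    triple a b c 0F = a
    triple a b c 1F = b
    triple a b c 2F = c

    -- As y is positive and ascending, a balanced row is ±(e_b + e_c - e_a) with b ≤ c < a.
    rows : ∀ ℓ → List (Row ℓ)
    rows ℓ = concatMap (λ a → concatMap (λ b → concatMap (λ c →
        if does (b Fin.≤? c) ∧ does (c Fin.<? a)
        then List.map (λ s → row (triple (b , s) (c , s) (a , Sign.opposite s))) signs
        else [])
      (allFin ℓ)) (allFin ℓ)) (allFin ℓ)

    module _ {ℓ : ℕ} where
      open DecMembership (Vec.≡-dec {n = ℓ} ℤ._≟_) using (_∈?_)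

      -- Completeness of `rows` is checked by computation: every sum of three vectors `±e_j` is
      -- either excluded by Abel summation or listed.
      covered : List (Row ℓ) → Bool
      covered rs = all (λ p → all (λ q → all (λ r →
        refuted (row (triple p q r)) ∨ ⌊ row (triple p q r) ∈? rs ⌋) ps) ps) ps
        where ps = signedIndices ℓ

      compatible : Fin ℓ → Row ℓ → List (Fin ℓ × Row ℓ) → Bool
      compatible i r = all (λ (j , s) → ⌊ lookup r j ℤ.≟ lookup s i ⌋)

      combination : Row ℓ → List (Fin ℓ × Row ℓ) → Row ℓ
      combination c []             = tabulate (λ _ → + 0)
      combination c ((j , r) ∷ rs) = scale (lookup c j) r ⊞ combination c rs

      -- Fills in the matrix row by row, pruning by symmetry with the rows already chosen. A full
      -- matrix is excluded when some `c` combines its rows to one that is nonzero on all ascending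
      -- positive `y`, whereas `By = 0` would make every combination vanish.
      search : List (Row ℓ) → List (Row ℓ) → List (Fin ℓ) → List (Fin ℓ × Row ℓ) → Bool
      search rs cs []         done = any (λ c → refuted (combination c done)) cs
      search rs cs (i ∷ todo) done = all (λ r → not (compatible i r done) ∨ search rs cs todo ((i , r) ∷ done)) rs

      module Soundness (y : Fin ℓ → ℤ) (asc : Ascending y) (1≤y : ∀ i → + 1 ℤ.≤ y i)
        (t : Fin ℓ → Fin 3 → SignedIndex ℓ) (bal : ∀ i → balance (t i) y ≡ + 0)
        (symm : ∀ i j → entry (t i) j ≡ entry (t j) i) where

        B : Fin ℓ → Row ℓ
        B i = row (t i)

        dot-B : ∀ i → dot (B i) y ≡ + 0
        dot-B i = trans (dot-row (t i) y) (bal i)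

        ∈-signedIndices : ∀ p → p ∈ signedIndices ℓ
        ∈-signedIndices (i , s) = Any.concatMap⁺ (λ i → List.map (i ,_) signs)
          (Any.tabulate⁺ i (Any.map⁺ (Any.map (cong (i ,_)) (∈-signs s))))
          where
          ∈-signs : ∀ s → s ∈ signs
          ∈-signs Sign.+ = Any.here refl
          ∈-signs Sign.- = Any.there (Any.here refl)

        B∈ : ∀ rs → T (covered rs) → ∀ i → B i ∈ rs
        B∈ rs cov i = [ (λ ref → contradiction (dot-B i) (refuted⇒dot≢0 (B i) y asc 1≤y ref)) , toWitness ]′
          (Equivalence.to (T-∨ {refuted (B i)}) (look (look (look cov (t i 0F)) (t i 1F)) (t i 2F)))
          where
          look : ∀ {p : SignedIndex ℓ → Bool} → T (all p (signedIndices ℓ)) → ∀ q → T (p q)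
          look {p} ok q = All.lookup (All.all⁺ p (signedIndices ℓ) ok) (∈-signedIndices q)

        Correct : List (Fin ℓ × Row ℓ) → Set
        Correct = All (λ (j , r) → r ≡ B j)

        dot-combination : ∀ c done → Correct done → dot (combination c done) y ≡ + 0
        dot-combination c []               []            = dot-0 y
        dot-combination c ((j , _) ∷ done) (refl ∷ cor) = begin
          dot (scale (lookup c j) (B j) ⊞ combination c done) y            ≡⟨ dot-⊞ (scale (lookup c j) (B j)) (combination c done) y ⟩
          dot (scale (lookup c j) (B j)) y + dot (combination c done) y    ≡⟨ cong₂ _+_ (dot-scale (lookup c j) (B j) y) (dot-combination c done cor) ⟩
          lookup c j * dot (B j) y + + 0                                   ≡⟨ cong (λ t → lookup c j * t + + 0) (dot-B j) ⟩
          lookup c j * + 0 + + 0                                           ≡⟨ cong (_+ + 0) (ℤ.*-zeroʳ (lookup c j)) ⟩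
          + 0                                                              ∎
          where open ≡-Reasoning

        compatible-B : ∀ i done → Correct done → T (compatible i (B i) done)
        compatible-B i done cor = All.all⁻ _ (All.map (λ { {j , _} refl → fromWitness
          (trans (lookup-row (t i) j) (trans (symm i j) (sym (lookup-row (t j) i)))) }) cor)

        -- Follows the branch of the actual rows `B i`: symmetry protects it from pruning, and at
        -- its leaf the refuted combination contradicts `By = 0`.
        search-sound : ∀ rs cs → (∀ i → B i ∈ rs) → ∀ todo done → Correct done → ¬ T (search rs cs todo done)
        search-sound rs cs B∈rs [] done cor ok =
          let c , ref = Any.satisfied (Any.any⁻ _ cs ok)
          in refuted⇒dot≢0 (combination c done) y asc 1≤y ref (dot-combination c done cor)
        search-sound rs cs B∈rs (i ∷ todo) done cor ok =
          search-sound rs cs B∈rs todo ((i , B i) ∷ done) (refl ∷ cor) (continue (All.lookup (All.all⁺ _ rs ok) (B∈rs i)))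
          where
          continue : T (not (compatible i (B i) done) ∨ search rs cs todo ((i , B i) ∷ done)) →
            T (search rs cs todo ((i , B i) ∷ done))
          continue with compatible i (B i) done | compatible-B i done cor
          ... | true | _ = λ ok → ok

    record Balanced (ℓ : ℕ) : Set where
      field
        y         : Fin ℓ → ℤ
        ascending : Ascending y
        1≤y       : ∀ i → + 1 ℤ.≤ y i
        t         : Fin ℓ → Fin 3 → SignedIndex ℓ
        balanced  : ∀ i → balance (t i) y ≡ + 0
        symmetric : ∀ i j → entry (t i) j ≡ entry (t j) i

    -- For a numeral `ℓ` both `T` premises evaluate to the unit type, so an underscore makes the
    -- type checker run the search.
    refute : ∀ ℓ → (cs : List (Row ℓ)) → T (covered (rows ℓ)) → T (search (rows ℓ) cs (allFin ℓ) []) → ¬ Balanced ℓ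
    refute ℓ cs cov ok bal = search-sound (rows ℓ) cs (B∈ (rows ℓ) cov) (allFin ℓ) [] [] ok
      where
      open Balanced bal
      open Soundness y ascending 1≤y t balanced symmetric

    -- The certificate list is empty for one and for two orbits: `rows 1` has no elements, and the
    -- rows `±(2, -1)` of `rows 2` do not form a symmetric matrix.
    ¬balanced₁ : ¬ Balanced 1
    ¬balanced₁ = refute 1 [] _ _

    ¬balanced₂ : ¬ Balanced 2
    ¬balanced₂ = refute 2 [] _ _

    -- The rows c passed to `refute` are Farkas certificates: for each symmetric matrix left by the
    -- search, the combination Σ cᵢ Bᵢ of its rows is refuted by Abel summation.
    ¬balanced₄ : ¬ Balanced 4
    ¬balanced₄ = refute 4 ((+ 1 ∷ + 1 ∷ + 1 ∷ + 2 ∷ []) ∷ []) _ _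

    ¬balanced₅ : ¬ Balanced 5
    ¬balanced₅ = refute 5
      ( (+ 1 ∷ + 1 ∷ + 2 ∷ + 2 ∷ + 3 ∷ [])
      ∷ (+ 1 ∷ + 2 ∷ + 1 ∷ + 2 ∷ + 3 ∷ [])
      ∷ (+ 0 ∷ + 1 ∷ + 0 ∷ + 1 ∷ + 1 ∷ [])
      ∷ (+ 0 ∷ + 1 ∷ + 1 ∷ + 1 ∷ + 2 ∷ [])
      ∷ (+ 1 ∷ -[1+ 2 ] ∷ -[1+ 2 ] ∷ -[1+ 1 ] ∷ -[1+ 1 ] ∷ [])
      ∷ []) _ _

  open Search

  -- Orbit representatives sorted by height.

  argmax : ∀ {n} {P : Fin n → Set} → Decidable P → (f : Fin n → ℕ) → ∃ P →
    ∃ λ v → P v × (∀ u → P u → f u ℕ.≤ f v)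
  argmax {suc n} {P} P? f (w , Pw) with Fin.any? (P? ∘ suc)
  ... | no none = zero , P0 w Pw , λ { zero _ → ℕ.≤-refl ; (suc u) Pu → contradiction (u , Pu) none }
    where
    P0 : ∀ w → P w → P zero
    P0 zero    p = p
    P0 (suc w) p = contradiction (w , p) none
  ... | yes some with argmax (P? ∘ suc) (f ∘ suc) some | P? zero
  ... | v , Pv , max | no ¬P0 = suc v , Pv , λ { zero p → contradiction p ¬P0 ; (suc u) p → max u p }
  ... | v , Pv , max | yes p0 with ℕ.≤-total (f zero) (f (suc v))
  ... | inj₁ le = suc v , Pv , λ { zero _ → le ; (suc u) p → max u p }
  ... | inj₂ ge = zero , p0 , λ { zero _ → ℕ.≤-refl ; (suc u) p → ℕ.≤-trans (max u p) ge }

  iter-+ : ∀ {A : Set} a b (f : A → A) x → iter (a ℕ.+ b) f x ≡ iter a f (iter b f x)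
  iter-+ zero    b f x = refl
  iter-+ (suc a) b f x = cong f (iter-+ a b f x)

  module Orbits {n : ℕ} (π : Fin n ↔ Fin n) (m : ℕ) .{{_ : NonZero m}} (size : ∀ v → OrbitSize π v m)
    (height : Fin n → ℕ) where

    σ : Fin n → Fin n
    σ = Inverse.to π

    _^σ_ : ℕ → Fin n → Fin n
    a ^σ v = iter a σ v

    ^σ-m* : ∀ q v → (q ℕ.* m) ^σ v ≡ v
    ^σ-m* zero    v = refl
    ^σ-m* (suc q) v = trans (iter-+ m (q ℕ.* m) σ v) (trans (cong (m ^σ_) (^σ-m* q v)) (proj₁ (size v)))

    ^σ-% : ∀ a v → (a ℕ.% m) ^σ v ≡ a ^σ v
    ^σ-% a v = sym (trans (cong (_^σ v) (ℕ.m≡m%n+[m/n]*n a m))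
      (trans (iter-+ (a ℕ.% m) (a ℕ./ m ℕ.* m) σ v) (cong ((a ℕ.% m) ^σ_) (^σ-m* (a ℕ./ m) v))))

    ^σ-back : ∀ {a} v → a ℕ.≤ m → (m ℕ.∸ a) ^σ (a ^σ v) ≡ v
    ^σ-back {a} v a≤m = trans (sym (iter-+ (m ℕ.∸ a) a σ v)) (trans (cong (_^σ v) (ℕ.m∸n+n≡m a≤m)) (proj₁ (size v)))

    ^σ-separates : ∀ {a b} v → a ℕ.< b → b ℕ.< m → a ^σ v ≢ b ^σ v
    ^σ-separates {a} {b} v a<b b<m eq = proj₂ (size (a ^σ v)) (b ℕ.∸ a) (ℕ.m<n⇒0<n∸m a<b)
      (ℕ.≤-<-trans (ℕ.m∸n≤m b a) b<m)
      (trans (sym (iter-+ (b ℕ.∸ a) a σ v)) (trans (cong (_^σ v) (ℕ.m∸n+n≡m (ℕ.<⇒≤ a<b))) (sym eq)))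

    ^σ-injective : ∀ v (a b : Fin m) → toℕ a ^σ v ≡ toℕ b ^σ v → a ≡ b
    ^σ-injective v a b eq with ℕ.<-cmp (toℕ a) (toℕ b)
    ... | tri< lt _ _ = contradiction eq (^σ-separates v lt (Fin.toℕ<n b))
    ... | tri≈ _ e _  = Fin.toℕ-injective e
    ... | tri> _ _ gt = contradiction (sym eq) (^σ-separates v gt (Fin.toℕ<n a))

    Covers : ∀ {k} → (Fin k → Fin n) → Fin n → Set
    Covers r v = ∃ λ i → ∃ λ (a : Fin m) → toℕ a ^σ r i ≡ v

    covers? : ∀ {k} (r : Fin k → Fin n) v → Dec (Covers r v)
    covers? r v = Fin.any? λ i → Fin.any? λ a → toℕ a ^σ r i Fin.≟ v

    covers-^σ : ∀ {k} (r : Fin k → Fin n) i a → Covers r (a ^σ r i)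
    covers-^σ r i a = i , a ℕ.mod m , trans (cong (_^σ r i) (Fin.toℕ-fromℕ< (ℕ.m%n<n a m))) (^σ-% a (r i))

    -- Representatives are chosen greedily from the highest orbit down, each new one being put in
    -- front, so that no separate sorting takes place. `lower` is the invariant that keeps the
    -- heights ascending.
    record Representatives (k : ℕ) : Set where
      field
        r         : Fin k → Fin n
        separated : ∀ {i j} (a b : Fin m) → toℕ a ^σ r i ≡ toℕ b ^σ r j → i ≡ j × a ≡ b
        ascending : ∀ i j → i Fin.≤ j → height (r i) ℕ.≤ height (r j)
        lower     : ∀ v → ¬ Covers r v → ∀ i → height v ℕ.≤ height (r i)

      bound : k ℕ.* m ℕ.≤ n
      bound = Fin.injective⇒≤ {f = λ q → toℕ (proj₂ (remQuot {k} m q)) ^σ r (proj₁ (remQuot {k} m q))} inj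
        where
        inj : Injective _≡_ _≡_ (λ q → toℕ (proj₂ (remQuot {k} m q)) ^σ r (proj₁ (remQuot {k} m q)))
        inj {p} {q} eq with separated (proj₂ (remQuot {k} m p)) (proj₂ (remQuot {k} m q)) eq
        ... | e₁ , e₂ = trans (sym (Fin.combine-remQuot {k} m p)) (trans (cong₂ combine e₁ e₂) (Fin.combine-remQuot {k} m q))

      bound-covers : (∀ v → Covers r v) → n ℕ.≤ k ℕ.* m
      bound-covers cov = Fin.injective⇒≤ {f = λ v → combine (proj₁ (cov v)) (proj₁ (proj₂ (cov v)))} inj
        where
        inj : Injective _≡_ _≡_ (λ v → combine (proj₁ (cov v)) (proj₁ (proj₂ (cov v))))
        inj {u} {v} eq with Fin.combine-injective (proj₁ (cov u)) (proj₁ (proj₂ (cov u))) (proj₁ (cov v)) (proj₁ (proj₂ (cov v))) eq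
        ... | e₁ , e₂ = trans (sym (proj₂ (proj₂ (cov u)))) (trans (cong₂ (λ i a → toℕ a ^σ r i) e₁ e₂) (proj₂ (proj₂ (cov v))))

    open Representatives

    adjoin : ∀ {k} (R : Representatives k) → ∃ (λ v → ¬ Covers (r R) v) → Representatives (suc k)
    adjoin {k} R ex = record { r = r′ ; separated = λ {i} {j} → sep i j ; ascending = asc ; lower = low }
      where
      best = argmax (λ v → ¬? (covers? (r R) v)) height ex
      v = proj₁ best
      v∉ = proj₁ (proj₂ best)
      max = proj₂ (proj₂ best)
      r′ : Fin (suc k) → Fin n
      r′ zero    = v
      r′ (suc i) = r R i
      new : ∀ j (a b : Fin m) → toℕ a ^σ v ≢ toℕ b ^σ r R j
      new j a b eq = v∉ (subst (Covers (r R)) (trans (iter-+ (m ℕ.∸ toℕ a) (toℕ b) σ (r R j))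
        (trans (cong ((m ℕ.∸ toℕ a) ^σ_) (sym eq)) (^σ-back v (ℕ.<⇒≤ (Fin.toℕ<n a)))))
        (covers-^σ (r R) j (m ℕ.∸ toℕ a ℕ.+ toℕ b)))
      sep : ∀ i j (a b : Fin m) → toℕ a ^σ r′ i ≡ toℕ b ^σ r′ j → i ≡ j × a ≡ b
      sep zero    zero    a b eq = refl , ^σ-injective v a b eq
      sep zero    (suc j) a b eq = contradiction eq (new j a b)
      sep (suc i) zero    a b eq = contradiction (sym eq) (new i b a)
      sep (suc i) (suc j) a b eq = let e₁ , e₂ = separated R a b eq in cong suc e₁ , e₂
      asc : ∀ i j → i Fin.≤ j → height (r′ i) ℕ.≤ height (r′ j)
      asc zero    zero    _           = ℕ.≤-refl
      asc zero    (suc j) _           = lower R v v∉ j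
      asc (suc i) (suc j) (ℕ.s≤s i≤j) = ascending R i j i≤j
      low : ∀ u → ¬ Covers r′ u → ∀ i → height u ℕ.≤ height (r′ i)
      low u u∉ i = cases i
        where
        u∉R : ¬ Covers (r R) u
        u∉R (i , a , eq) = u∉ (suc i , a , eq)
        cases : ∀ i → height u ℕ.≤ height (r′ i)
        cases zero    = max u u∉R
        cases (suc i) = lower R u u∉R i

    module _ (ℓ : ℕ) (n≡ : n ≡ ℓ ℕ.* m) where

      -- Covering all vertices would give `n ≤ k * m`, which is less than `ℓ * m`.
      uncovered : ∀ {k} (R : Representatives k) → k ℕ.< ℓ → ∃ λ v → ¬ Covers (r R) v
      uncovered {k} R k<ℓ = Fin.¬∀⟶∃¬ n (Covers (r R)) (covers? (r R)) λ cov →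
        ℕ.<⇒≱ (subst (k ℕ.* m ℕ.<_) (sym n≡) (ℕ.*-monoˡ-< m k<ℓ)) (bound-covers R cov)

      build : ∀ k → k ℕ.≤ ℓ → Representatives k
      build zero    _   = record { r = λ () ; separated = λ { {()} } ; ascending = λ () ; lower = λ _ _ () }
      build (suc k) k<ℓ = let R = build k (ℕ.<⇒≤ k<ℓ) in adjoin R (uncovered R k<ℓ)

      representatives : Representatives ℓ
      representatives = build ℓ ℕ.≤-refl

      -- An uncovered vertex would yield a further orbit, hence `(ℓ + 1) * m ≤ n`.
      covers : ∀ v → Covers (r representatives) v
      covers v with covers? (r representatives) v
      ... | yes c = c
      ... | no ¬c = contradiction (bound (adjoin representatives (v , ¬c)))
        (ℕ.<⇒≱ (subst (ℕ._< suc ℓ ℕ.* m) (sym n≡) (ℕ.m<n+m (ℓ ℕ.* m) (ℕ.>-nonZero⁻¹ m))))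

      rep : Fin ℓ → Fin n
      rep = r representatives

      orb : Fin n → Fin ℓ
      orb v = proj₁ (covers v)

      time : Fin n → Fin m
      time v = proj₁ (proj₂ (covers v))

      rep-orb : ∀ v → toℕ (time v) ^σ rep (orb v) ≡ v
      rep-orb v = proj₂ (proj₂ (covers v))

      orb-^σ : ∀ i a → orb (toℕ a ^σ rep i) ≡ i
      orb-^σ i a = proj₁ (separated representatives (time w) a (rep-orb w))
        where w = toℕ a ^σ rep i

      time-^σ : ∀ i a → time (toℕ a ^σ rep i) ≡ a
      time-^σ i a = proj₂ (separated representatives (time w) a (rep-orb w))
        where w = toℕ a ^σ rep i

      orb-σ : ∀ v → orb (σ v) ≡ orb v
      orb-σ v = begin
        orb (σ v)                                     ≡⟨ cong (orb ∘ σ) (rep-orb v) ⟨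
        orb (suc (toℕ (time v)) ^σ rep (orb v))       ≡⟨ cong orb mod-eq ⟩
        orb (toℕ b ^σ rep (orb v))                    ≡⟨ orb-^σ (orb v) b ⟩
        orb v                                         ∎
        where
        open ≡-Reasoning
        b = suc (toℕ (time v)) ℕ.mod m
        mod-eq : suc (toℕ (time v)) ^σ rep (orb v) ≡ toℕ b ^σ rep (orb v)
        mod-eq = sym (proj₂ (proj₂ (covers-^σ rep (orb v) (suc (toℕ (time v))))))

      -- Turns a sum over vertices into a double sum over orbits and positions within an orbit.
      coordinates : Fin (ℓ ℕ.* m) ↔ Fin n
      coordinates = mk↔ₛ′ (λ q → toℕ (proj₂ (remQuot {ℓ} m q)) ^σ rep (proj₁ (remQuot {ℓ} m q)))
        (λ v → combine (orb v) (time v))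
        (λ v → trans (cong (λ (i , a) → toℕ a ^σ rep i) (Fin.remQuot-combine (orb v) (time v))) (rep-orb v))
        (λ q → trans (cong₂ combine (orb-^σ _ (proj₂ (remQuot {ℓ} m q))) (time-^σ _ (proj₂ (remQuot {ℓ} m q)))) (Fin.combine-remQuot {ℓ} m q))

      coordinates-combine : ∀ i a → Inverse.to coordinates (combine i a) ≡ toℕ a ^σ rep i
      coordinates-combine i a = cong (λ (i , a) → toℕ a ^σ rep i) (Fin.remQuot-combine i a)

  -- Sums over neighbourhoods and over orbits.

  support : ∀ {n} → (Fin n → Bool) → List (Fin n)
  support {zero}  p = []
  support {suc n} p = if p zero then zero ∷ rest else rest
    where rest = List.map suc (support (p ∘ suc))

  length-support : ∀ {n} (p : Fin n → Bool) → length (support p) ≡ sumℕ n (λ j → if p j then 1 else 0)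
  length-support {zero}  p = refl
  length-support {suc n} p with p zero
  ... | true  = cong suc (trans (List.length-map suc (support (p ∘ suc))) (length-support (p ∘ suc)))
  ... | false = trans (List.length-map suc (support (p ∘ suc))) (length-support (p ∘ suc))

  module SupportSum (M : CommutativeMonoid 0ℓ 0ℓ) where
    open CommutativeMonoid M renaming (refl to ≈-refl; sym to ≈-sym; trans to ≈-trans)
    open Sum M

    listSum : List Carrier → Carrier
    listSum = List.foldr _∙_ ε

    support-sum : ∀ {n} (p : Fin n → Bool) (f : Fin n → Carrier) →
      sum (λ j → if p j then f j else ε) ≈ listSum (List.map f (support p))
    support-sum {zero}  p f = ≈-refl
    support-sum {suc n} p f with p zero
    ... | true  = ∙-congˡ (≈-trans (support-sum (p ∘ suc) (f ∘ suc)) (reflexive (cong listSum (List.map-∘ (support (p ∘ suc))))))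
    ... | false = ≈-trans (identityˡ _)
      (≈-trans (support-sum (p ∘ suc) (f ∘ suc)) (reflexive (cong listSum (List.map-∘ (support (p ∘ suc))))))

    sum-++ : ∀ a {b} (f : Fin (a ℕ.+ b) → Carrier) → sum f ≈ sum (λ i → f (i ↑ˡ b)) ∙ sum (λ j → f (a ↑ʳ j))
    sum-++ zero    f = ≈-sym (identityˡ _)
    sum-++ (suc a) f = ≈-trans (∙-congˡ (sum-++ a (f ∘ suc))) (≈-sym (assoc _ _ _))

    sum-combine : ∀ a {b} (f : Fin (a ℕ.* b) → Carrier) → sum f ≈ sum (λ i → sum (λ j → f (combine {a} i j)))
    sum-combine zero    f = ≈-refl
    sum-combine (suc a) {b} f = ≈-trans (sum-++ b f) (∙-congˡ (sum-combine a (λ q → f (b ↑ʳ q))))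

  module SumℤM = Sum ℤ.+-0-commutativeMonoid
  open SumℤM using (sum)

  sum-const : ∀ m c → sum {m} (λ _ → c) ≡ + m ℤ.* c
  sum-const zero    c = sym (ℤ.*-zeroˡ c)
  sum-const (suc m) c = trans (cong (λ t → c ℤ.+ t) (sum-const m c)) (sym (ℤ.suc-* (+ m) c))

  -- The signed quotient matrix of a cubic nut graph.

  module Quotient {n : ℕ} (G : Graph n) (cubic : Cubic G) (π : Fin n ↔ Fin n) (auto : IsAutomorphism G π)
    (m : ℕ) .{{_ : NonZero m}} (size : ∀ v → OrbitSize π v m) (nut : Nut G) where

    σ : Fin n → Fin n
    σ = Inverse.to π

    nbrs : Fin n → List (Fin n)
    nbrs u = support (adj G u)

    private
      three : ∀ {A : Set} (xs : List A) → length xs ≡ 3 → Σ (Fin 3 → A) λ g → xs ≡ g 0F ∷ g 1F ∷ g 2F ∷ []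
      three (a ∷ b ∷ c ∷ []) refl = triple a b c , refl

      nbr-list : ∀ u → Σ (Fin 3 → Fin n) λ g → nbrs u ≡ g 0F ∷ g 1F ∷ g 2F ∷ []
      nbr-list u = three (nbrs u) (trans (length-support (adj G u)) (cubic u))

    nbr : Fin n → Fin 3 → Fin n
    nbr u = proj₁ (nbr-list u)

    module NbrSum (M : CommutativeMonoid 0ℓ 0ℓ) where
      open CommutativeMonoid M renaming (refl to ≈-refl; sym to ≈-sym; trans to ≈-trans)

      nbr-sum : ∀ u (f : Fin n → Carrier) → Sum.sum M (λ v → if adj G u v then f v else ε) ≈
        f (nbr u 0F) ∙ f (nbr u 1F) ∙ f (nbr u 2F)
      nbr-sum u f = ≈-trans (SupportSum.support-sum M (adj G u) f)
        (≈-trans (reflexive (cong (SupportSum.listSum M ∘ List.map f) (proj₂ (nbr-list u))))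
        (≈-trans (∙-congˡ (∙-congˡ (identityʳ _))) (≈-sym (assoc _ _ _))))

    A·-sum : ∀ x u → (A· G) x u ≡ SumℚM.sum (λ v → if adj G u v then x v else 0ℚ)
    A·-sum x u = trans (sumℚ≡sum n _) (SumℚM.sum-cong-≗ λ v → entry-≡ v)
      where
      entry-≡ : ∀ v → A[ G ] u v ℚ.* x v ≡ (if adj G u v then x v else 0ℚ)
      entry-≡ v with adj G u v
      ... | true  = ℚ.*-identityˡ (x v)
      ... | false = ℚ.*-zeroˡ (x v)

    x : Fin n → ℚ
    x = proj₁ (proj₂ nut)

    x≢0 : ∀ i → x i ≢ 0ℚ
    x≢0 = proj₁ (proj₂ (proj₂ nut))

    x-kernel : InKernel G x
    x-kernel = proj₁ (proj₂ (proj₂ (proj₂ nut)))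

    xσ-kernel : InKernel G (x ∘ σ)
    xσ-kernel u = begin
      (A· G) (x ∘ σ) u                                                  ≡⟨ A·-sum (x ∘ σ) u ⟩
      SumℚM.sum (λ v → if adj G u v then x (σ v) else 0ℚ)               ≡⟨ SumℚM.sum-cong-≗ (λ v → cong (if_then x (σ v) else 0ℚ) (auto u v)) ⟨
      SumℚM.sum (λ v → if adj G (σ u) (σ v) then x (σ v) else 0ℚ)       ≡⟨ SumℚM.sum-permute (λ v → if adj G (σ u) v then x v else 0ℚ) π ⟨
      SumℚM.sum (λ v → if adj G (σ u) v then x v else 0ℚ)               ≡⟨ A·-sum x (σ u) ⟨
      (A· G) x (σ u)                                                    ≡⟨ x-kernel (σ u) ⟩
      0ℚ                                                                ∎
      where open ≡-Reasoning

    private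
      scaled = proj₂ (proj₂ (proj₂ (proj₂ nut))) (x ∘ σ) xσ-kernel
      c = proj₁ scaled
      xσ = proj₂ scaled
      cleared = common-denominator n x
      D = fromℤ (+ suc (proj₁ cleared))

    z : Fin n → ℤ
    z = proj₁ (proj₂ cleared)

    private
      z≡ : ∀ i → fromℤ (z i) ≡ D ℚ.* x i
      z≡ = proj₂ (proj₂ cleared)

    z≢0 : ∀ i → z i ≢ + 0
    z≢0 i eq = x≢0 i (*-cancelˡ-0 (fromℤ-suc≢0 (proj₁ cleared)) (trans (sym (z≡ i)) (cong fromℤ eq)))

    -- The relation `x ∘ σ = c x` with its rational factor eliminated, so that absolute values and
    -- signs can be taken among integers.
    z-cross : ∀ u v → z (σ v) ℤ.* z u ≡ z (σ u) ℤ.* z v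
    z-cross u v = fromℤ-injective (begin
      fromℤ (z (σ v) ℤ.* z u)                   ≡⟨ fromℤ-* (z (σ v)) (z u) ⟩
      fromℤ (z (σ v)) ℚ.* fromℤ (z u)           ≡⟨ cong₂ ℚ._*_ (trans (z≡ (σ v)) (cong (D ℚ.*_) (xσ v))) (z≡ u) ⟩
      (D ℚ.* (c ℚ.* x v)) ℚ.* (D ℚ.* x u)
        ≡⟨ solve 4 (λ D c v u → (D :* (c :* v)) :* (D :* u) := (D :* (c :* u)) :* (D :* v)) refl D c (x v) (x u) ⟩
      (D ℚ.* (c ℚ.* x u)) ℚ.* (D ℚ.* x v)       ≡⟨ cong₂ ℚ._*_ (trans (z≡ (σ u)) (cong (D ℚ.*_) (xσ u))) (z≡ v) ⟨
      fromℤ (z (σ u)) ℚ.* fromℤ (z v)           ≡⟨ fromℤ-* (z (σ u)) (z v) ⟨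
      fromℤ (z (σ u) ℤ.* z v)                   ∎)
      where
      open ≡-Reasoning
      open ℚSolver.+-*-Solver

    height : Fin n → ℕ
    height v = ∣ z v ∣

    height-cross : ∀ u v → height (σ v) ℕ.* height u ≡ height (σ u) ℕ.* height v
    height-cross u v = trans (sym (ℤ.abs-* (z (σ v)) (z u))) (trans (cong ∣_∣ (z-cross u v)) (ℤ.abs-* (z (σ u)) (z v)))

    height≢0 : ∀ v → height v ≢ 0
    height≢0 v eq = z≢0 v (ℤ.∣i∣≡0⇒i≡0 eq)

    iter-mono : ∀ {f : Fin n → ℕ} → (∀ v → f (σ v) ℕ.≤ f v) → ∀ a v → f (iter a σ v) ℕ.≤ f v
    iter-mono dec zero    v = ℕ.≤-refl
    iter-mono dec (suc a) v = ℕ.≤-trans (dec (iter a σ v)) (iter-mono dec a v)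

    iter-mono′ : ∀ {f : Fin n → ℕ} → (∀ v → f v ℕ.≤ f (σ v)) → ∀ a v → f v ℕ.≤ f (iter a σ v)
    iter-mono′ inc zero    v = ℕ.≤-refl
    iter-mono′ inc (suc a) v = ℕ.≤-trans (iter-mono′ inc a v) (inc (iter a σ v))

    return : ∀ u → iter (ℕ.pred m) σ (σ u) ≡ u
    return u = trans (sym (iter-+ (ℕ.pred m) 1 σ u))
      (trans (cong (λ a → iter a σ u) (trans (ℕ.+-comm (ℕ.pred m) 1) (ℕ.suc-pred m))) (proj₁ (size u)))

    -- The ratio of heights along σ is constant, and σ has finite order.
    height-σ : ∀ u → height (σ u) ≡ height u
    height-σ u with ℕ.≤-total (height (σ u)) (height u)
    ... | inj₁ le = ℕ.≤-antisym le (subst (λ w → height w ℕ.≤ height (σ u)) (return u) (iter-mono dec (ℕ.pred m) (σ u)))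
      where
      dec : ∀ v → height (σ v) ℕ.≤ height v
      dec v = ℕ.*-cancelʳ-≤ (height (σ v)) (height v) (height u) {{ℕ.≢-nonZero (height≢0 u)}} (begin
        height (σ v) ℕ.* height u  ≡⟨ height-cross u v ⟩
        height (σ u) ℕ.* height v  ≤⟨ ℕ.*-monoˡ-≤ (height v) le ⟩
        height u ℕ.* height v      ≡⟨ ℕ.*-comm (height u) (height v) ⟩
        height v ℕ.* height u      ∎)
        where open ℕ.≤-Reasoning
    ... | inj₂ ge = ℕ.≤-antisym (subst (λ w → height (σ u) ℕ.≤ height w) (return u) (iter-mono′ inc (ℕ.pred m) (σ u))) ge
      where
      inc : ∀ v → height v ℕ.≤ height (σ v)
      inc v = ℕ.*-cancelʳ-≤ (height v) (height (σ v)) (height u) {{ℕ.≢-nonZero (height≢0 u)}} (begin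
        height v ℕ.* height u      ≡⟨ ℕ.*-comm (height v) (height u) ⟩
        height u ℕ.* height v      ≤⟨ ℕ.*-monoˡ-≤ (height v) ge ⟩
        height (σ u) ℕ.* height v  ≡⟨ height-cross u v ⟨
        height (σ v) ℕ.* height u  ∎)
        where open ℕ.≤-Reasoning

    sg : Fin n → Sign
    sg v = sign (z v)

    sg-cross : ∀ u v → sg (σ v) Sign.* sg u ≡ sg (σ u) Sign.* sg v
    sg-cross u v = trans (sym (sign-*′ (σ v) u)) (trans (cong sign (z-cross u v)) (sign-*′ (σ u) v))
      where
      sign-*′ : ∀ u v → sign (z u ℤ.* z v) ≡ sg u Sign.* sg v
      sign-*′ u v = ℤ.sign-* (z u) (z v)
        {{ℤ.i*j≢0 (z u) (z v) {{ℤ.≢-nonZero (z≢0 u)}} {{ℤ.≢-nonZero (z≢0 v)}}}}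

    -- `σ` multiplies all signs by one common factor, which cancels in a product of two.
    sg-σ : ∀ u v → sg (σ u) Sign.* sg (σ v) ≡ sg u Sign.* sg v
    sg-σ u v = swap (sg (σ u)) (sg (σ v)) (sg u) (sg v) (sg-cross u v)
      where
      swap : ∀ a b c d → b Sign.* c ≡ a Sign.* d → a Sign.* b ≡ c Sign.* d
      swap Sign.+ Sign.+ Sign.+ Sign.+ _ = refl
      swap Sign.+ Sign.+ Sign.- Sign.- _ = refl
      swap Sign.+ Sign.- Sign.+ Sign.- _ = refl
      swap Sign.+ Sign.- Sign.- Sign.+ _ = refl
      swap Sign.- Sign.+ Sign.+ Sign.- _ = refl
      swap Sign.- Sign.+ Sign.- Sign.+ _ = refl
      swap Sign.- Sign.- Sign.+ Sign.+ _ = refl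
      swap Sign.- Sign.- Sign.- Sign.- _ = refl

    z-kernel : ∀ u → z (nbr u 0F) ℤ.+ z (nbr u 1F) ℤ.+ z (nbr u 2F) ≡ + 0
    z-kernel u = fromℤ-injective (begin
      fromℤ (a ℤ.+ b ℤ.+ d)                 ≡⟨ trans (fromℤ-+ (a ℤ.+ b) d) (cong (ℚ._+ fromℤ d) (fromℤ-+ a b)) ⟩
      fromℤ a ℚ.+ fromℤ b ℚ.+ fromℤ d       ≡⟨ cong₂ ℚ._+_ (cong₂ ℚ._+_ (z≡ (nbr u 0F)) (z≡ (nbr u 1F))) (z≡ (nbr u 2F)) ⟩
      D ℚ.* x (nbr u 0F) ℚ.+ D ℚ.* x (nbr u 1F) ℚ.+ D ℚ.* x (nbr u 2F)
        ≡⟨ solve 4 (λ D a b c → D :* a :+ D :* b :+ D :* c := D :* (a :+ b :+ c)) refl D (x (nbr u 0F)) (x (nbr u 1F)) (x (nbr u 2F)) ⟩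
      D ℚ.* (x (nbr u 0F) ℚ.+ x (nbr u 1F) ℚ.+ x (nbr u 2F))
        ≡⟨ cong (D ℚ.*_) (trans (sym (NbrSum.nbr-sum ℚ.+-0-commutativeMonoid u x)) (trans (sym (A·-sum x u)) (x-kernel u))) ⟩
      D ℚ.* 0ℚ                              ≡⟨ ℚ.*-zeroʳ D ⟩
      0ℚ                                    ∎)
      where
      open ≡-Reasoning
      open ℚSolver.+-*-Solver
      a = z (nbr u 0F)
      b = z (nbr u 1F)
      d = z (nbr u 2F)

    open Orbits π m size height hiding (σ)

    module _ (ℓ : ℕ) (n≡ : n ≡ ℓ ℕ.* m) where

      rp : Fin ℓ → Fin n
      rp = rep ℓ n≡

      ob : Fin n → Fin ℓ
      ob = orb ℓ n≡

      height-iter : ∀ a v → height (iter a σ v) ≡ height v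
      height-iter zero    v = refl
      height-iter (suc a) v = trans (height-σ (iter a σ v)) (height-iter a v)

      height-rp : ∀ v → height (rp (ob v)) ≡ height v
      height-rp v = trans (sym (height-iter (toℕ (time ℓ n≡ v)) (rp (ob v)))) (cong height (rep-orb ℓ n≡ v))

      t : Fin ℓ → Fin 3 → SignedIndex ℓ
      t i k = ob v , sg (rp i) Sign.* sg v
        where v = nbr (rp i) k

      y : Fin ℓ → ℤ
      y i = + height (rp i)

      pairing : Fin n → Fin n → Fin ℓ → ℤ
      pairing u v j = if does (ob v Fin.≟ j) then ⟪ sg u Sign.* sg v ⟫ else + 0

      -- The signed number of neighbours of `u` in orbit `j`, an edge `uv` having the sign of
      -- `z u * z v`. At a representative it is an entry of `B`.
      F : Fin ℓ → Fin n → ℤ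
      F j u = sum (λ v → if adj G u v then pairing u v j else + 0)

      F-rp : ∀ i j → F j (rp i) ≡ entry (t i) j
      F-rp i j = NbrSum.nbr-sum ℤ.+-0-commutativeMonoid (rp i) (λ v → pairing (rp i) v j)

      F-σ : ∀ j u → F j (σ u) ≡ F j u
      F-σ j u = trans (SumℤM.sum-permute (λ v → if adj G (σ u) v then pairing (σ u) v j else + 0) π)
        (SumℤM.sum-cong-≗ λ v → cong₂ (choose (+ 0)) (auto u v)
          (cong₂ (λ i s → if does (i Fin.≟ j) then ⟪ s ⟫ else + 0) (orb-σ ℓ n≡ v) (sg-σ u v)))
        where
        choose : ∀ {A : Set} → A → Bool → A → A
        choose e b a = if b then a else e

      F-iter : ∀ j a u → F j (iter a σ u) ≡ F j u
      F-iter j zero    u = refl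
      F-iter j (suc a) u = trans (F-σ j (iter a σ u)) (F-iter j a u)

      -- `F j` is constant on orbit `i`, which has `m` points.
      orbit-sum : ∀ i j → sum (λ u → if does (ob u Fin.≟ i) then F j u else + 0) ≡ + m ℤ.* F j (rp i)
      orbit-sum i j = begin
        sum (λ u → if does (ob u Fin.≟ i) then F j u else + 0)
          ≡⟨ SumℤM.sum-permute (λ u → if does (ob u Fin.≟ i) then F j u else + 0) (coordinates ℓ n≡) ⟩
        sum (λ q → term (Inverse.to (coordinates ℓ n≡) q))
          ≡⟨ SupportSum.sum-combine ℤ.+-0-commutativeMonoid ℓ (λ q → term (Inverse.to (coordinates ℓ n≡) q)) ⟩
        sum {ℓ} (λ i′ → sum {m} (λ a → term (Inverse.to (coordinates ℓ n≡) (combine i′ a))))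
          ≡⟨ SumℤM.sum-cong-≗ (λ i′ → trans (SumℤM.sum-cong-≗ (λ a → term≡ i′ a)) (trans (sum-const m _) (*-if (does (i Fin.≟ i′)) _))) ⟩
        sum {ℓ} (λ i′ → if does (i Fin.≟ i′) then + m ℤ.* F j (rp i′) else + 0)
          ≡⟨ ImageSum.δ-sum ℤ.+-0-commutativeMonoid i (λ i′ → + m ℤ.* F j (rp i′)) ⟩
        + m ℤ.* F j (rp i) ∎
        where
        open ≡-Reasoning
        term : Fin n → ℤ
        term u = if does (ob u Fin.≟ i) then F j u else + 0
        term≡ : ∀ i′ a → term (Inverse.to (coordinates ℓ n≡) (combine i′ a)) ≡ (if does (i Fin.≟ i′) then F j (rp i′) else + 0)
        term≡ i′ a = begin
          term (Inverse.to (coordinates ℓ n≡) (combine i′ a))  ≡⟨ cong term (coordinates-combine ℓ n≡ i′ a) ⟩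
          term (iter (toℕ a) σ (rp i′))
            ≡⟨ cong₂ (λ k f → if does (k Fin.≟ i) then f else + 0) (orb-^σ ℓ n≡ i′ a) (F-iter j (toℕ a) (rp i′)) ⟩
          (if does (i′ Fin.≟ i) then F j (rp i′) else + 0)
            ≡⟨ cong (if_then F j (rp i′) else + 0) (does-⇔ (mk⇔ sym sym) (i′ Fin.≟ i) (i Fin.≟ i′)) ⟩
          (if does (i Fin.≟ i′) then F j (rp i′) else + 0) ∎
        *-if : ∀ b f → + m ℤ.* (if b then f else + 0) ≡ (if b then + m ℤ.* f else + 0)
        *-if true  f = refl
        *-if false f = ℤ.*-zeroʳ (+ m)

      W : Fin ℓ → Fin ℓ → Fin n → Fin n → ℤ
      W i j u v = if does (ob u Fin.≟ i) then (if adj G u v then pairing u v j else + 0) else + 0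

      W-sym : ∀ i j u v → W i j u v ≡ W j i v u
      W-sym i j u v rewrite adj-sym G u v | Sign.*-comm (sg u) (sg v)
        with does (ob u Fin.≟ i) | does (ob v Fin.≟ j) | adj G v u
      ... | true  | true  | true  = refl
      ... | true  | true  | false = refl
      ... | true  | false | true  = refl
      ... | true  | false | false = refl
      ... | false | true  | true  = refl
      ... | false | true  | false = refl
      ... | false | false | true  = refl
      ... | false | false | false = refl

      orbit-sum-W : ∀ i j → + m ℤ.* F j (rp i) ≡ sum (λ u → sum (W i j u))
      orbit-sum-W i j = trans (sym (orbit-sum i j)) (SumℤM.sum-cong-≗ λ u → pull (does (ob u Fin.≟ i)) (λ v → if adj G u v then pairing u v j else + 0))
        where
        pull : ∀ b (f : Fin n → ℤ) → (if b then sum f else + 0) ≡ sum (λ v → if b then f v else + 0)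
        pull true  f = refl
        pull false f = sym (ImageSum.sum-0 ℤ.+-0-commutativeMonoid {n} (λ _ → + 0) (λ _ → refl))

      -- Multiplied by `m`, both sides count the signed edges between orbits `i` and `j`, each from
      -- its own end; the orbits having the same size, `m` cancels.
      F-sym : ∀ i j → F j (rp i) ≡ F i (rp j)
      F-sym i j = ℤ.*-cancelˡ-≡ (+ m) (F j (rp i)) (F i (rp j)) (begin
        + m ℤ.* F j (rp i)           ≡⟨ orbit-sum-W i j ⟩
        sum (λ u → sum (W i j u))    ≡⟨ SumℤM.∑-comm (W i j) ⟩
        sum (λ v → sum (λ u → W i j u v)) ≡⟨ SumℤM.sum-cong-≗ (λ v → SumℤM.sum-cong-≗ (λ u → W-sym i j u v)) ⟩
        sum (λ v → sum (W j i v))    ≡⟨ orbit-sum-W j i ⟨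
        + m ℤ.* F i (rp j)           ∎)
        where open ≡-Reasoning

      -- Heights are constant on orbits, so `y (ob v)` is the absolute value of `z v`, and the sign
      -- of `v` restores `z v`. Thus the balance of row `i` is the kernel equation at `rp i` times
      -- the sign of `rp i`.
      term≡ : ∀ i k (let v = nbr (rp i) k) → ⟪ sg (rp i) Sign.* sg v ⟫ ℤ.* y (ob v) ≡ ⟪ sg (rp i) ⟫ ℤ.* z v
      term≡ i k = begin
        ⟪ s Sign.* sg v ⟫ ℤ.* (+ height (rp (ob v)))   ≡⟨ cong (λ h → ⟪ s Sign.* sg v ⟫ ℤ.* (+ h)) (height-rp v) ⟩
        ⟪ s Sign.* sg v ⟫ ℤ.* (+ height v)             ≡⟨ cong (ℤ._* (+ height v)) (ℤ.◃-distrib-* s (sg v) 1 1) ⟩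
        ⟪ s ⟫ ℤ.* ⟪ sg v ⟫ ℤ.* (+ height v)            ≡⟨ ℤ.*-assoc ⟪ s ⟫ ⟪ sg v ⟫ (+ height v) ⟩
        ⟪ s ⟫ ℤ.* (⟪ sg v ⟫ ℤ.* (+ height v))          ≡⟨ cong (⟪ s ⟫ ℤ.*_) (sign-abs (z v)) ⟩
        ⟪ s ⟫ ℤ.* z v                                  ∎
        where
        open ≡-Reasoning
        v = nbr (rp i) k
        s = sg (rp i)
        sign-abs : ∀ a → ⟪ sign a ⟫ ℤ.* (+ ∣ a ∣) ≡ a
        sign-abs a = begin
          (sign a ℤ.◃ 1) ℤ.* (+ ∣ a ∣)              ≡⟨ cong ((sign a ℤ.◃ 1) ℤ.*_) (sym (ℤ.+◃n≡+n ∣ a ∣)) ⟩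
          (sign a ℤ.◃ 1) ℤ.* (Sign.+ ℤ.◃ ∣ a ∣)     ≡⟨ ℤ.◃-distrib-* (sign a) Sign.+ 1 ∣ a ∣ ⟨
          (sign a Sign.* Sign.+) ℤ.◃ (1 ℕ.* ∣ a ∣)  ≡⟨ cong₂ ℤ._◃_ (Sign.*-identityʳ (sign a)) (ℕ.*-identityˡ ∣ a ∣) ⟩
          sign a ℤ.◃ ∣ a ∣                          ≡⟨ ℤ.◃-inverse a ⟩
          a                                         ∎

      quotient-balanced : Balanced ℓ
      quotient-balanced = record
        { y         = y
        ; ascending = λ i j i≤j → ℤ.+≤+ (Representatives.ascending (representatives ℓ n≡) i j i≤j)
        ; 1≤y       = λ i → ℤ.+≤+ (ℕ.n≢0⇒n>0 (height≢0 (rp i)))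
        ; t         = t
        ; balanced  = λ i → begin
            balance (t i) y  ≡⟨ cong₂ ℤ._+_ (cong₂ ℤ._+_ (term≡ i 0F) (term≡ i 1F)) (term≡ i 2F) ⟩
            s i ℤ.* z (nbr (rp i) 0F) ℤ.+ s i ℤ.* z (nbr (rp i) 1F) ℤ.+ s i ℤ.* z (nbr (rp i) 2F)
              ≡⟨ solve 4 (λ s a b c → s :* a :+ s :* b :+ s :* c := s :* (a :+ b :+ c)) refl
                   (s i) (z (nbr (rp i) 0F)) (z (nbr (rp i) 1F)) (z (nbr (rp i) 2F)) ⟩
            s i ℤ.* (z (nbr (rp i) 0F) ℤ.+ z (nbr (rp i) 1F) ℤ.+ z (nbr (rp i) 2F))
              ≡⟨ cong (s i ℤ.*_) (z-kernel (rp i)) ⟩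
            s i ℤ.* (+ 0)      ≡⟨ ℤ.*-zeroʳ (s i) ⟩
            + 0              ∎
        ; symmetric = λ i j → trans (sym (F-rp i j)) (trans (F-sym i j) (F-rp j i))
        }
        where
        open ≡-Reasoning
        open ℤSolver.+-*-Solver
        s : Fin ℓ → ℤ
        s i = ⟪ sg (rp i) ⟫

  nonexistence : ∀ ℓ → ¬ Balanced ℓ → ∀ G → ¬ CubicCirculantNut ℓ G
  nonexistence ℓ ¬bal (n , G) (cubic , (π , auto , m , 1≤m , n≡ , size) , nut) =
    ¬bal (Quotient.quotient-balanced G cubic π auto m {{ℕ.>-nonZero 1≤m}} size nut ℓ n≡)

theorem2 : (ℓ : ℕ) → 1 ≤ ℓ →
    ((ℓ ≡ 1 ⊎ ℓ ≡ 2 ⊎ ℓ ≡ 4 ⊎ ℓ ≡ 5) →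
    ∀ (G : AnyGraph) → ¬ CubicCirculantNut ℓ G) ×
    ((ℓ ≡ 3 ⊎ ℓ ≡ 6 ⊎ ℓ ≡ 7 ⊎ 9 ≤ ℓ) →
    Σ (ℕ → AnyGraph) (λ F → (∀ (k : ℕ) → CubicCirculantNut ℓ (F k)) ×
    (∀ (i j : ℕ) → i ≢ j → ¬ IsoAny (F i) (F j))))
theorem2 ℓ _ = none , Existence.existence ℓ
  where
  open Nonexistence using (nonexistence)
  open Nonexistence.Search
  none : (ℓ ≡ 1 ⊎ ℓ ≡ 2 ⊎ ℓ ≡ 4 ⊎ ℓ ≡ 5) → ∀ G → ¬ CubicCirculantNut ℓ G
  none (inj₁ refl)               = nonexistence 1 ¬balanced₁
  none (inj₂ (inj₁ refl))        = nonexistence 2 ¬balanced₂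
  none (inj₂ (inj₂ (inj₁ refl))) = nonexistence 4 ¬balanced₄
  none (inj₂ (inj₂ (inj₂ refl))) = nonexistence 5 ¬balanced₅
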